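{- Let $a$ be an odd integer, let $k,m$ be positive integers with $m\ge 5$, and let $b\in\{0,2,4,\ldots\}$. Then $$\begin{aligned}E_{2^mk+b}^{(a)}-E_b^{(a)}\equiv{}& 2^{m}k\{7ab^6-6ab^5+(3a^3-14a)b^4+(4a^3+56a)b^3\\&-(6a^4+35a^3-12a^2+106a-122)b^2+(38a^3-8a-256)b\\&+(70a^3+64a^2-81a+448)\\&+2^{m}k(b^4+2b^3+2ab^2+(a^3+2a)b+16-a^3)\}\pmod{2^{m+10}}.\end{aligned}$$
   Context: For a nonzero integer $a$, the sequence $\{E_n^{(a)}\}_{n\ge 0}$ is the sequence of integers defined recursively by $$\sum_{j=0}^{\lfloor n/2\rfloor}\binom{n}{2j}a^{2j}E_{n-2j}^{(a)}=(1-a)^n\quad(n=0,1,2,\ldots).$$ -}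

module Defs where

open import Data.Fin.Base using (Fin; toℕ)
open import Data.Fin.Properties using (toℕ<n)
open import Data.Integer.Base using (ℤ; +_; _+_; _-_; _*_; _^_; 1ℤ)
open import Data.Integer.Divisibility.Signed using (_∣_)
open import Data.Integer.Properties using (+-0-monoid; *-identityˡ)
open import Data.Integer.Tactic.RingSolver using (solve-∀)
open import Data.Nat.Base as ℕ using (ℕ; zero; suc; ⌊_/2⌋; _∸_; _<_; s≤s; z≤n)
open import Data.Nat.Combinatorics using (_C_)
open import Data.Nat.Induction using (<-rec; <-Rec; <-wellFounded)
open import Data.Nat.Properties using (m∸n≤m)
open import Data.Product.Base using (∃)
open import Induction.WellFounded using (module FixPoint)
open import Relation.Binary.PropositionalEquality

open import Algebra.Properties.Monoid.Sum +-0-monoid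

infix 4 _≡_[mod_]

_≡_[mod_] : ℤ → ℤ → ℤ → Set
x ≡ y [mod n ] = n ∣ x - y

Odd : ℤ → Set
Odd a = ∃ λ c → a ≡ + 2 * c + 1ℤ

private
  index< : ∀ {n} (i : Fin ⌊ n /2⌋) → n ∸ 2 ℕ.* suc (toℕ i) < n
  index< {suc (suc n)} i = s≤s (m∸n≤m (suc n) (toℕ i ℕ.+ suc (toℕ i ℕ.+ 0)))

  step : (a : ℤ) (n : ℕ) → <-Rec (λ _ → ℤ) n → ℤ
  step a n rec = (1ℤ - a) ^ n -
    ∑[ i < ⌊ n /2⌋ ] (+ (n C (2 ℕ.* suc (toℕ i))) * a ^ (2 ℕ.* suc (toℕ i)) * rec (index< i))

-- E a n is Eₙ⁽ᵃ⁾: the defining recurrence (see E-recurrence), solved for its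
-- j = 0 term, whose coefficient is 1.  In the sum, j = suc (toℕ i).
-- The definition also makes sense for a = 0.
E : ℤ → ℕ → ℤ
E a = <-rec (λ _ → ℤ) (step a)

private
  E-unfold : ∀ a n → E a n ≡ step a n (λ {m} _ → E a m)
  E-unfold a n = FixPoint.unfold-wfRec <-wellFounded (λ _ → ℤ) (step a)
    (λ m eq → cong ((1ℤ - a) ^ m -_)
      (sum-cong-≗ {⌊ m /2⌋} (λ i → cong (+ (m C (2 ℕ.* suc (toℕ i))) * a ^ (2 ℕ.* suc (toℕ i)) *_) (eq (index< i))))) {n}

E-recurrence : ∀ a n →
  ∑[ j ≤ ⌊ n /2⌋ ] (+ (n C (2 ℕ.* toℕ j)) * a ^ (2 ℕ.* toℕ j) * E a (n ∸ 2 ℕ.* toℕ j))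
    ≡ (1ℤ - a) ^ n
E-recurrence a n = trans (cong (λ e → 1ℤ * 1ℤ * e + S) (E-unfold a n)) (cancel ((1ℤ - a) ^ n) S)
  where
  S : ℤ
  S = ∑[ i < ⌊ n /2⌋ ] (+ (n C (2 ℕ.* suc (toℕ i))) * a ^ (2 ℕ.* suc (toℕ i)) * E a (n ∸ 2 ℕ.* suc (toℕ i)))

  cancel : ∀ p s → 1ℤ * 1ℤ * (p - s) + s ≡ p
  cancel = solve-∀

module Submission where

-- Idea.  Read a sequence v as the linear functional xⁱ ↦ v i on ℤ[x].  The defining
-- recurrence says that E a, taken at (x − 1)ⁿ, gives a sequence q with
-- q((x + 2a)ⁿ) + q(xⁿ) = 2 · 0ⁿ.  Hence q n is aⁿ times a coefficient of 1 − tanh z =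
-- Σ tₙ zⁿ/n!, and 2^⌊n/2⌋ ∣ q n.  The n-th difference e n of t ↦ E(2t) at 0 is q taken at
-- xⁿ(x + 2)ⁿ, which makes it highly 2-divisible: 2ⁿ ∣ e n, and 2¹⁴ ∣ e n for n ≥ 8.
-- Put N = 2T and b = 2s.  The j-th difference of E(N + b) − E(b) in s is
-- Σ_{i ≥ 1} (T C i) e(i + j), where modulo 2^(m+10) only the terms with i + j ≤ 7 survive.
-- The right-hand side has degree 6 in s, so it remains to compare differences for j ≤ 6.
-- These are congruences between explicit polynomials in T/16 and d, where a = 4d + 1 or
-- a = 4d + 3, and they hold coefficient by coefficient.

open import Defs
open import Data.Bool.Base using (Bool; true; _∧_; T)
open import Data.Bool.Properties using (T-∧)
open import Data.Fin as Fin using (Fin; toℕ; #_)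
open import Data.Integer.Base as ℤ using (ℤ; +_; -[1+_]; _+_; _-_; -_; _*_; _^_; 0ℤ; 1ℤ; -1ℤ)
open import Data.Integer.Divisibility.Signed renaming (_∣_ to _∣ℤ_)
import Data.Integer.Properties as ℤ
open import Data.Integer.Tactic.RingSolver using (solve-∀)
open import Data.List.Base using (List; []; _∷_; map)
open import Data.Nat.Base as ℕ using (ℕ; zero; suc; _∸_; _≤_; _<_; _≥_; ⌊_/2⌋; z≤n; s≤s; _!)
open import Data.Nat.Combinatorics
  using (_C_; nCk+nC[k+1]≡[n+1]C[k+1]; nCk≡nC[n∸k]; nC1≡n; nCn≡1; k>n⇒nCk≡0)
open import Data.Nat.Divisibility as ℕ using (_∣_)
open import Data.Nat.Induction using (<-rec)
import Data.Nat.Properties as ℕ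
open import Data.Product.Base using (∃; _×_; _,_; proj₁; proj₂)
open import Data.Sum.Base using (_⊎_; inj₁; inj₂; [_,_]′)
open import Data.Vec.Base using (Vec; []; _∷_; lookup)
open import Function.Base using (_∘_)
open import Function.Bundles using (Equivalence)
open import Relation.Binary.PropositionalEquality
open import Relation.Nullary.Decidable using (isYes; toWitness)

open import Algebra.Properties.AbelianGroup ℤ.+-0-abelianGroup using (∙-cancelˡ)
open import Algebra.Properties.Monoid.Sum ℤ.+-0-monoid using (sum-syntax; sum⁺-syntax)
open ≡-Reasoning

-- Finite sums of integers.

∑< : ℕ → (ℕ → ℤ) → ℤ
∑< zero    f = 0ℤ
∑< (suc n) f = f 0 + ∑< n (f ∘ suc)

∑<-cong : ∀ n {f g} → (∀ i → i < n → f i ≡ g i) → ∑< n f ≡ ∑< n g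
∑<-cong zero    f≡g = refl
∑<-cong (suc n) f≡g = cong₂ _+_ (f≡g 0 (s≤s z≤n)) (∑<-cong n (λ i i<n → f≡g (suc i) (s≤s i<n)))

∑<-+ : ∀ n f g → ∑< n (λ i → f i + g i) ≡ ∑< n f + ∑< n g
∑<-+ zero    f g = refl
∑<-+ (suc n) f g = trans (cong (_+_ (f 0 + g 0)) (∑<-+ n (f ∘ suc) (g ∘ suc)))
  (lemma (f 0) (g 0) (∑< n (f ∘ suc)) (∑< n (g ∘ suc)))
  where
  lemma : ∀ a b c d → (a + b) + (c + d) ≡ (a + c) + (b + d)
  lemma = solve-∀

∑<-* : ∀ n c f → ∑< n (λ i → c * f i) ≡ c * ∑< n f
∑<-* zero    c f = sym (ℤ.*-zeroʳ c)
∑<-* (suc n) c f = trans (cong (λ z → c * f 0 + z) (∑<-* n c (f ∘ suc)))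
  (sym (ℤ.*-distribˡ-+ c (f 0) (∑< n (f ∘ suc))))

∑<-++ : ∀ m n f → ∑< (m ℕ.+ n) f ≡ ∑< m f + ∑< n (λ i → f (m ℕ.+ i))
∑<-++ zero    n f = sym (ℤ.+-identityˡ _)
∑<-++ (suc m) n f = trans (cong (_+_ (f 0)) (∑<-++ m n (f ∘ suc))) (sym (ℤ.+-assoc (f 0) _ _))

∑<-last : ∀ n f → ∑< (suc n) f ≡ ∑< n f + f n
∑<-last zero    f = trans (ℤ.+-identityʳ (f 0)) (sym (ℤ.+-identityˡ (f 0)))
∑<-last (suc n) f = trans (cong (_+_ (f 0)) (∑<-last n (f ∘ suc))) (sym (ℤ.+-assoc (f 0) _ _))

∑<-∣ : ∀ {d} n {f} → (∀ i → i < n → d ∣ℤ f i) → d ∣ℤ ∑< n f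
∑<-∣ zero    d∣f = divides 0ℤ refl
∑<-∣ (suc n) d∣f = ∣m∣n⇒∣m+n (d∣f 0 (s≤s z≤n)) (∑<-∣ n (λ i i<n → d∣f (suc i) (s≤s i<n)))

∑<-Fin : ∀ n f → ∑[ i < n ] f (toℕ i) ≡ ∑< n f
∑<-Fin zero    f = refl
∑<-Fin (suc n) f = cong (_+_ (f 0)) (∑<-Fin n (f ∘ suc))

-- Matches the index j of the recurrence: once the odd terms of a full binomial expansion cancel,
-- the survivors are numbered by half their index.
∑<-even : ∀ n f → (∀ i → f (suc (2 ℕ.* i)) ≡ 0ℤ) →
  ∑< (suc n) f ≡ ∑< (suc ⌊ n /2⌋) (λ i → f (2 ℕ.* i))
∑<-even zero          f odd = refl
∑<-even (suc zero)    f odd = cong (λ z → f 0 + (z + 0ℤ)) (odd 0)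
∑<-even (suc (suc n)) f odd = cong (_+_ (f 0)) (begin
  f 1 + ∑< (suc n) (f ∘ suc ∘ suc)                          ≡⟨ cong (_+ ∑< (suc n) (f ∘ suc ∘ suc)) (odd 0) ⟩
  0ℤ + ∑< (suc n) (f ∘ suc ∘ suc)                           ≡⟨ ℤ.+-identityˡ _ ⟩
  ∑< (suc n) (f ∘ suc ∘ suc)                                ≡⟨ ∑<-even n (f ∘ suc ∘ suc) (λ i → trans (cong f (cong suc (sym (ℕ.*-suc 2 i)))) (odd (suc i))) ⟩
  ∑< (suc ⌊ n /2⌋) (λ i → f (suc (suc (2 ℕ.* i))))          ≡⟨ ∑<-cong (suc ⌊ n /2⌋) (λ i _ → cong f (sym (ℕ.*-suc 2 i))) ⟩
  ∑< (suc ⌊ n /2⌋) (λ i → f (2 ℕ.* suc i))                  ∎)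

-- Binomial sums.

-- Expands (x + y)ⁿ one factor at a time, with `g i j` in place of xⁱyʲ. In this form symmetry and
-- linearity are plain inductions without binomial coefficients.
bin : (ℕ → ℕ → ℤ) → ℕ → ℤ
bin g zero    = g 0 0
bin g (suc n) = bin (λ i j → g (suc i) j) n + bin (λ i j → g i (suc j)) n

bin-swap : ∀ g n → bin (λ i j → g j i) n ≡ bin g n
bin-swap g zero    = refl
bin-swap g (suc n) = trans (cong₂ _+_ (bin-swap (λ i j → g i (suc j)) n) (bin-swap (λ i j → g (suc i) j) n))
  (ℤ.+-comm (bin (λ i j → g i (suc j)) n) (bin (λ i j → g (suc i) j) n))

bin-sum : ∀ g n → bin g n ≡ ∑< (suc n) (λ i → + (n C i) * g i (n ∸ i))
bin-sum g zero    = sym (trans (ℤ.+-identityʳ _) (ℤ.*-identityˡ (g 0 0)))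
bin-sum g (suc n) = begin
  bin (λ i j → g (suc i) j) n + bin (λ i j → g i (suc j)) n
    ≡⟨ cong₂ _+_ (bin-sum (λ i j → g (suc i) j) n) (bin-sum (λ i j → g i (suc j)) n) ⟩
  L + (1ℤ * g 0 (suc n) + ∑< n (λ i → + (n C suc i) * g (suc i) (suc (n ∸ suc i))))
    ≡⟨ cong (λ z → L + (1ℤ * g 0 (suc n) + z)) R≡ ⟩
  L + (1ℤ * g 0 (suc n) + R)
    ≡⟨ swap L (1ℤ * g 0 (suc n)) R ⟩
  1ℤ * g 0 (suc n) + (L + R)
    ≡⟨ cong (λ z → 1ℤ * g 0 (suc n) + z) (sym (∑<-+ (suc n) (λ i → + (n C i) * g (suc i) (n ∸ i)) (λ i → + (n C suc i) * g (suc i) (n ∸ i)))) ⟩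
  1ℤ * g 0 (suc n) + ∑< (suc n) (λ i → + (n C i) * g (suc i) (n ∸ i) + + (n C suc i) * g (suc i) (n ∸ i))
    ≡⟨ cong (λ z → 1ℤ * g 0 (suc n) + z) (∑<-cong (suc n) (λ i _ → pascal i (g (suc i) (n ∸ i)))) ⟩
  1ℤ * g 0 (suc n) + ∑< (suc n) (λ i → + (suc n C suc i) * g (suc i) (n ∸ i)) ∎
  where
  L R : ℤ
  L = ∑< (suc n) (λ i → + (n C i) * g (suc i) (n ∸ i))
  R = ∑< (suc n) (λ i → + (n C suc i) * g (suc i) (n ∸ i))

  R≡ : ∑< n (λ i → + (n C suc i) * g (suc i) (suc (n ∸ suc i))) ≡ R
  R≡ = begin
    ∑< n (λ i → + (n C suc i) * g (suc i) (suc (n ∸ suc i)))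
      ≡⟨ ∑<-cong n (λ i i<n → cong (λ z → + (n C suc i) * g (suc i) z) (sym (ℕ.+-∸-assoc 1 i<n))) ⟩
    ∑< n (λ i → + (n C suc i) * g (suc i) (n ∸ i))
      -- The term i = n can be appended because n C (n + 1) = 0; then `L` and `R` have the same
      -- range and Pascal's rule applies termwise.
      ≡⟨ sym (ℤ.+-identityʳ _) ⟩
    ∑< n (λ i → + (n C suc i) * g (suc i) (n ∸ i)) + 0ℤ * g (suc n) (n ∸ n)
      ≡⟨ cong (λ c → ∑< n (λ i → + (n C suc i) * g (suc i) (n ∸ i)) + + c * g (suc n) (n ∸ n)) (sym (k>n⇒nCk≡0 (ℕ.n<1+n n))) ⟩
    ∑< n (λ i → + (n C suc i) * g (suc i) (n ∸ i)) + + (n C suc n) * g (suc n) (n ∸ n)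
      ≡⟨ sym (∑<-last n (λ i → + (n C suc i) * g (suc i) (n ∸ i))) ⟩
    R ∎

  swap : ∀ a b c → a + (b + c) ≡ b + (a + c)
  swap = solve-∀

  pascal : ∀ i z → + (n C i) * z + + (n C suc i) * z ≡ + (suc n C suc i) * z
  pascal i z = trans (sym (ℤ.*-distribʳ-+ z (+ (n C i)) (+ (n C suc i))))
    (cong (λ c → + c * z) (nCk+nC[k+1]≡[n+1]C[k+1] n i))

-- Linear functionals on ℤ[x] and translation of the variable.

mul-x+ : ℤ → (ℕ → ℤ) → ℕ → ℤ
mul-x+ c v n = v (suc n) + c * v n

-- tau c v n is the value of the functional xⁱ ↦ v i at (x + c)ⁿ.
tau : ℤ → (ℕ → ℤ) → ℕ → ℤ
tau c v zero    = v 0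
tau c v (suc n) = tau c (mul-x+ c v) n

tau-cong : ∀ c {u v} → u ≗ v → tau c u ≗ tau c v
tau-cong c u≗v zero    = u≗v 0
tau-cong c u≗v (suc n) = tau-cong c (λ i → cong₂ (λ x y → x + c * y) (u≗v (suc i)) (u≗v i)) n

tau-linear : ∀ c k u v → tau c (λ n → u n + k * v n) ≗ λ n → tau c u n + k * tau c v n
tau-linear c k u v zero    = refl
tau-linear c k u v (suc n) = trans
  (tau-cong c (λ i → lemma c k (u (suc i)) (v (suc i)) (u i) (v i)) n)
  (tau-linear c k (mul-x+ c u) (mul-x+ c v) n)
  where
  lemma : ∀ c k u′ v′ u v → (u′ + k * v′) + c * (u + k * v) ≡ (u′ + c * u) + k * (v′ + c * v)
  lemma = solve-∀

-- Translations compose additively: by linearity a factor x + c outside `tau d` becomes a factor x +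
-- (d + c) inside it.
tau-∘ : ∀ c d v → tau c (tau d v) ≗ tau (d + c) v
tau-∘ c d v zero    = refl
tau-∘ c d v (suc n) = trans (tau-cong c shift n) (tau-∘ c d (mul-x+ (d + c) v) n)
  where
  shift : mul-x+ c (tau d v) ≗ tau d (mul-x+ (d + c) v)
  shift i = trans (sym (tau-linear d c (mul-x+ d v) v i))
    (tau-cong d (λ j → lemma c d (v (suc j)) (v j)) i)
    where
    lemma : ∀ c d x y → (x + d * y) + c * y ≡ x + (d + c) * y
    lemma = solve-∀

-- The sequence of powers of r is evaluation at x = r. The scalar k is carried along so that the
-- induction can absorb one factor r + c per step.
tau-^ : ∀ c k r → tau c (λ n → k * r ^ n) ≗ λ n → k * (r + c) ^ n
tau-^ c k r zero    = refl
tau-^ c k r (suc n) = trans (tau-cong c (λ i → lemma₁ c k r (r ^ i)) n)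
  (trans (tau-^ c (k * (r + c)) r n) (lemma₂ k (r + c) ((r + c) ^ n)))
  where
  lemma₁ : ∀ c k r x → k * (r * x) + c * (k * x) ≡ (k * (r + c)) * x
  lemma₁ = solve-∀
  lemma₂ : ∀ k s x → (k * s) * x ≡ k * (s * x)
  lemma₂ = solve-∀

tau-0 : ∀ v → tau 0ℤ v ≗ v
tau-0 v zero    = refl
tau-0 v (suc n) = trans (tau-cong 0ℤ (λ i → ℤ.+-identityʳ (v (suc i))) n) (tau-0 (v ∘ suc) n)

-- Splits (x + c)ⁿ⁺ʲ as a product: the inner functional sends xˢ to the value of `v` at xˢ(x + c)ⁿ.
tau-+ : ∀ c v n j → tau c v (n ℕ.+ j) ≡ tau c (λ s → tau c (λ i → v (s ℕ.+ i)) n) j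
tau-+ c v zero    j = tau-cong c (λ s → cong v (sym (ℕ.+-identityʳ s))) j
tau-+ c v (suc n) j = trans (tau-+ c (mul-x+ c v) n j)
  (tau-cong c (λ s → tau-cong c (λ i → cong (λ z → v z + c * v (s ℕ.+ i)) (sym (ℕ.+-suc s i))) n) j)

bin-cong : ∀ {g h} → (∀ i j → g i j ≡ h i j) → bin g ≗ bin h
bin-cong g≡h zero    = g≡h 0 0
bin-cong g≡h (suc n) = cong₂ _+_ (bin-cong (λ i j → g≡h (suc i) j) n) (bin-cong (λ i j → g≡h i (suc j)) n)

bin-* : ∀ c g → bin (λ i j → c * g i j) ≗ λ n → c * bin g n
bin-* c g zero    = refl
bin-* c g (suc n) = trans (cong₂ _+_ (bin-* c (λ i j → g (suc i) j) n) (bin-* c (λ i j → g i (suc j)) n))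
  (sym (ℤ.*-distribˡ-+ c (bin (λ i j → g (suc i) j) n) (bin (λ i j → g i (suc j)) n)))

tau-bin : ∀ c v → tau c v ≗ bin (λ i j → c ^ j * v i)
tau-bin c v zero    = sym (ℤ.*-identityˡ (v 0))
tau-bin c v (suc n) = trans (tau-linear c c (v ∘ suc) v n)
  (cong₂ _+_ (tau-bin c (v ∘ suc) n)
    (trans (cong (c *_) (tau-bin c v n))
      (trans (sym (bin-* c (λ i j → c ^ j * v i) n))
        (bin-cong (λ i j → sym (ℤ.*-assoc c (c ^ j) (v i))) n))))

tau-sum : ∀ c v n → tau c v n ≡ ∑< (suc n) (λ i → + (n C i) * (c ^ (n ∸ i) * v i))
tau-sum c v n = trans (tau-bin c v n) (bin-sum (λ i j → c ^ j * v i) n)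

tau-sum′ : ∀ c v n → tau c v n ≡ ∑< (suc n) (λ i → + (n C i) * (c ^ i * v (n ∸ i)))
tau-sum′ c v n = trans (tau-bin c v n)
  (trans (sym (bin-swap (λ i j → c ^ j * v i) n)) (bin-sum (λ i j → c ^ i * v j) n))

-- The substitution x ↦ rx, under which (rx + rc)ⁿ = rⁿ(x + c)ⁿ; k again serves the induction.
tau-scale : ∀ c r k v → tau (r * c) (λ j → k * (r ^ j * v j)) ≗ λ n → k * (r ^ n * tau c v n)
tau-scale c r k v zero    = refl
tau-scale c r k v (suc n) = trans (tau-cong (r * c) (λ i → lemma c r k (r ^ i) (v (suc i)) (v i)) n)
  (trans (tau-scale c r (k * r) (mul-x+ c v) n) (lemma′ k r (r ^ n) (tau c (mul-x+ c v) n)))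
  where
  lemma : ∀ c r k p x y → k * (r * p * x) + r * c * (k * (p * y)) ≡ (k * r) * (p * (x + c * y))
  lemma = solve-∀
  lemma′ : ∀ k r p x → (k * r) * (p * x) ≡ k * (r * p * x)
  lemma′ = solve-∀

tau-last : ∀ c v n → tau c v n ≡ ∑< n (λ i → + (n C i) * (c ^ (n ∸ i) * v i)) + v n
tau-last c v n = trans (tau-sum c v n) (trans (∑<-last n _)
  (cong (_+_ (∑< n (λ i → + (n C i) * (c ^ (n ∸ i) * v i)))) (begin
    + (n C n) * (c ^ (n ∸ n) * v n) ≡⟨ cong₂ (λ x y → + x * (c ^ y * v n)) (nCn≡1 n) (ℕ.n∸n≡0 n) ⟩
    1ℤ * (1ℤ * v n)                 ≡⟨ trans (ℤ.*-identityˡ _) (ℤ.*-identityˡ _) ⟩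
    v n                             ∎)))

-- The top coefficient of (x + c)ⁿ is 1, so the n-th equation fixes twice the n-th value in terms of
-- earlier ones. The bound N admits sequences known only as finite tables.
tau-unique : ∀ c u v N → (∀ n → n < N → tau c u n + u n ≡ tau c v n + v n) →
  ∀ n → n < N → u n ≡ v n
tau-unique c u v N eq = <-rec _ λ n ih n<N → ℤ.*-cancelˡ-≡ (+ 2) (u n) (v n) (∙-cancelˡ (S n v) _ _ (begin
  S n v + + 2 * u n   ≡⟨ cong (_+ + 2 * u n) (∑<-cong n (λ i i<n → cong (λ z → + (n C i) * (c ^ (n ∸ i) * z)) (sym (ih i<n (ℕ.<-trans i<n n<N))))) ⟩
  S n u + + 2 * u n   ≡⟨ double (S n u) (u n) ⟩
  (S n u + u n) + u n ≡⟨ cong (_+ u n) (sym (tau-last c u n)) ⟩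
  tau c u n + u n     ≡⟨ eq n n<N ⟩
  tau c v n + v n     ≡⟨ cong (_+ v n) (tau-last c v n) ⟩
  (S n v + v n) + v n ≡⟨ sym (double (S n v) (v n)) ⟩
  S n v + + 2 * v n   ∎))
  where
  S : ℕ → (ℕ → ℤ) → ℤ
  S n w = ∑< n (λ i → + (n C i) * (c ^ (n ∸ i) * w i))
  double : ∀ s x → s + + 2 * x ≡ (s + x) + x
  double = solve-∀

-- The recurrence of `E` as an identity of functionals.

^-even : ∀ a i → (- a) ^ (2 ℕ.* i) ≡ a ^ (2 ℕ.* i)
^-even a i = begin
  (- a) ^ (2 ℕ.* i)   ≡⟨ ℤ.^-*-assoc (- a) 2 i ⟨
  ((- a) ^ 2) ^ i     ≡⟨ cong (_^ i) (square a) ⟩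
  (a ^ 2) ^ i         ≡⟨ ℤ.^-*-assoc a 2 i ⟩
  a ^ (2 ℕ.* i)       ∎
  where
  square : ∀ a → - a * (- a * 1ℤ) ≡ a * (a * 1ℤ)
  square = solve-∀

-- In (x + a)ⁿ + (x - a)ⁿ the odd powers of a cancel and the even ones double, which leaves twice
-- the defining recurrence.
E-functional : ∀ a n → tau a (E a) n + tau (- a) (E a) n ≡ + 2 * (1ℤ - a) ^ n
E-functional a n = begin
  tau a (E a) n + tau (- a) (E a) n
    ≡⟨ cong₂ _+_ (tau-sum′ a (E a) n) (tau-sum′ (- a) (E a) n) ⟩
  ∑< (suc n) (λ i → + (n C i) * (a ^ i * E a (n ∸ i))) + ∑< (suc n) (λ i → + (n C i) * ((- a) ^ i * E a (n ∸ i)))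
    ≡⟨ sym (∑<-+ (suc n) (λ i → + (n C i) * (a ^ i * E a (n ∸ i))) (λ i → + (n C i) * ((- a) ^ i * E a (n ∸ i)))) ⟩
  ∑< (suc n) f
    ≡⟨ ∑<-even n f (λ i → trans (cong (λ z → + (n C suc (2 ℕ.* i)) * (a * a ^ (2 ℕ.* i) * E a (n ∸ suc (2 ℕ.* i)))
                                          + + (n C suc (2 ℕ.* i)) * (- a * z * E a (n ∸ suc (2 ℕ.* i)))) (^-even a i))
         (odd (+ (n C suc (2 ℕ.* i))) a (a ^ (2 ℕ.* i)) (E a (n ∸ suc (2 ℕ.* i))))) ⟩
  ∑< (suc ⌊ n /2⌋) (λ i → f (2 ℕ.* i))
    ≡⟨ ∑<-cong (suc ⌊ n /2⌋) (λ i _ → trans (cong (λ z → + (n C (2 ℕ.* i)) * (a ^ (2 ℕ.* i) * E a (n ∸ 2 ℕ.* i))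
                                          + + (n C (2 ℕ.* i)) * (z * E a (n ∸ 2 ℕ.* i))) (^-even a i))
         (even (+ (n C (2 ℕ.* i))) (a ^ (2 ℕ.* i)) (E a (n ∸ 2 ℕ.* i)))) ⟩
  ∑< (suc ⌊ n /2⌋) (λ i → + 2 * g i)
    ≡⟨ ∑<-* (suc ⌊ n /2⌋) (+ 2) g ⟩
  + 2 * ∑< (suc ⌊ n /2⌋) g
    ≡⟨ cong (+ 2 *_) (sym (∑<-Fin (suc ⌊ n /2⌋) g)) ⟩
  + 2 * (∑[ j ≤ ⌊ n /2⌋ ] g (toℕ j))
    ≡⟨ cong (+ 2 *_) (E-recurrence a n) ⟩
  + 2 * (1ℤ - a) ^ n ∎
  where
  f g : ℕ → ℤ
  f i = + (n C i) * (a ^ i * E a (n ∸ i)) + + (n C i) * ((- a) ^ i * E a (n ∸ i))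
  g i = + (n C (2 ℕ.* i)) * a ^ (2 ℕ.* i) * E a (n ∸ 2 ℕ.* i)
  odd : ∀ c a p e → c * (a * p * e) + c * (- a * p * e) ≡ 0ℤ
  odd = solve-∀
  even : ∀ c p e → c * (p * e) + c * (p * e) ≡ + 2 * (c * p * e)
  even = solve-∀

q : ℤ → ℕ → ℤ
q a = tau -1ℤ (E a)

-- Translating `E-functional` by a - 1 moves the points a and -a to 2a - 1 and -1, and the base 1 -
-- a of the right-hand side to 0.
q-functional : ∀ a n → tau (+ 2 * a) (q a) n + q a n ≡ + 2 * 0ℤ ^ n
q-functional a n = begin
  tau (+ 2 * a) (q a) n + q a n
    ≡⟨ cong (_+ q a n) (tau-∘ (+ 2 * a) -1ℤ (E a) n) ⟩
  tau (-1ℤ + + 2 * a) (E a) n + q a n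
    ≡⟨ cong₂ (λ c d → tau c (E a) n + tau d (E a) n) (c₁ a) (c₂ a) ⟩
  tau (a + (a - 1ℤ)) (E a) n + tau (- a + (a - 1ℤ)) (E a) n
    ≡⟨ cong₂ _+_ (sym (tau-∘ (a - 1ℤ) a (E a) n)) (trans (sym (tau-∘ (a - 1ℤ) (- a) (E a) n)) (sym (ℤ.*-identityˡ _))) ⟩
  tau (a - 1ℤ) (tau a (E a)) n + 1ℤ * tau (a - 1ℤ) (tau (- a) (E a)) n
    ≡⟨ sym (tau-linear (a - 1ℤ) 1ℤ (tau a (E a)) (tau (- a) (E a)) n) ⟩
  tau (a - 1ℤ) (λ i → tau a (E a) i + 1ℤ * tau (- a) (E a) i) n
    ≡⟨ tau-cong (a - 1ℤ) (λ i → trans (cong (_+_ (tau a (E a) i)) (ℤ.*-identityˡ _)) (E-functional a i)) n ⟩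
  tau (a - 1ℤ) (λ i → + 2 * (1ℤ - a) ^ i) n
    ≡⟨ tau-^ (a - 1ℤ) (+ 2) (1ℤ - a) n ⟩
  + 2 * ((1ℤ - a) + (a - 1ℤ)) ^ n
    ≡⟨ cong (λ z → + 2 * z ^ n) (c₃ a) ⟩
  + 2 * 0ℤ ^ n ∎
  where
  c₁ : ∀ a → -1ℤ + + 2 * a ≡ a + (a - 1ℤ)
  c₁ = solve-∀
  c₂ : ∀ a → -1ℤ ≡ - a + (a - 1ℤ)
  c₂ = solve-∀
  c₃ : ∀ a → (1ℤ - a) + (a - 1ℤ) ≡ 0ℤ
  c₃ = solve-∀

-- Explicit initial values of `q` from the tanh numbers.

entry : List ℤ → ℕ → ℤ
entry []       n       = 0ℤ
entry (x ∷ xs) zero    = x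
entry (x ∷ xs) (suc n) = entry xs n

-- The coefficients of zⁿ/n! in 1 − tanh z for n < 27, and 0 from there on.
tan : ℕ → ℤ
tan = entry (+ 1 ∷ - + 1 ∷ + 0 ∷ + 2 ∷ + 0 ∷ - + 16 ∷ + 0 ∷ + 272 ∷ + 0 ∷ - + 7936 ∷ + 0 ∷
  + 353792 ∷ + 0 ∷ - + 22368256 ∷ + 0 ∷ + 1903757312 ∷ + 0 ∷ - + 209865342976 ∷ + 0 ∷
  + 29088885112832 ∷ + 0 ∷ - + 4951498053124096 ∷ + 0 ∷ + 1015423886506852352 ∷ + 0 ∷
  - + 246921480190207983616 ∷ [])

-- Coefficientwise this is (e²ᶻ + 1)(1 - tanh z) = 2, verified on the table. The bound 27 is what
-- `e a n` with n < 14 requires: it involves `q` up to index 26.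
tan-functional : ∀ {n} → n < 27 → tau (+ 2) tan n + tan n ≡ + 2 * 0ℤ ^ n
tan-functional {n} n<27 = trans (cong (_+ tan n) (tau-sum (+ 2) tan n)) (check n<27)
  where
  lhs : ℕ → ℤ
  lhs n = ∑< (suc n) (λ i → + (n C i) * ((+ 2) ^ (n ∸ i) * tan i)) + tan n
  check : ∀ {n} → n < 27 → lhs n ≡ + 2 * 0ℤ ^ n
  check = toWitness {a? = ℕ.allUpTo? (λ n → lhs n ℤ.≟ (+ 2 * 0ℤ ^ n)) 27} _

-- Rescaling by a turns the equation of `tan` into that of `q a`; the right-hand side is unchanged,
-- being 0 for n > 0, and `tau-unique` applies.
q-tan : ∀ a n → n < 27 → q a n ≡ a ^ n * tan n
q-tan a = tau-unique (+ 2 * a) (q a) (λ n → a ^ n * tan n) 27 λ n n<27 → begin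
  tau (+ 2 * a) (q a) n + q a n                  ≡⟨ q-functional a n ⟩
  + 2 * 0ℤ ^ n                                   ≡⟨ scale n ⟩
  a ^ n * (+ 2 * 0ℤ ^ n)                         ≡⟨ cong (a ^ n *_) (sym (tan-functional n<27)) ⟩
  a ^ n * (tau (+ 2) tan n + tan n)              ≡⟨ ℤ.*-distribˡ-+ (a ^ n) _ _ ⟩
  a ^ n * tau (+ 2) tan n + a ^ n * tan n        ≡⟨ cong (_+ a ^ n * tan n) (scaled n) ⟩
  tau (+ 2 * a) (λ n → a ^ n * tan n) n + a ^ n * tan n ∎
  where
  scale : ∀ n → + 2 * 0ℤ ^ n ≡ a ^ n * (+ 2 * 0ℤ ^ n)
  scale zero    = refl
  scale (suc n) = sym (ℤ.*-zeroʳ (a ^ suc n))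
  scaled : ∀ n → a ^ n * tau (+ 2) tan n ≡ tau (+ 2 * a) (λ n → a ^ n * tan n) n
  scaled n = begin
    a ^ n * tau (+ 2) tan n                             ≡⟨ sym (ℤ.*-identityˡ _) ⟩
    1ℤ * (a ^ n * tau (+ 2) tan n)                      ≡⟨ sym (tau-scale (+ 2) a 1ℤ tan n) ⟩
    tau (a * + 2) (λ j → 1ℤ * (a ^ j * tan j)) n        ≡⟨ cong (λ c → tau c (λ j → 1ℤ * (a ^ j * tan j)) n) (ℤ.*-comm a (+ 2)) ⟩
    tau (+ 2 * a) (λ j → 1ℤ * (a ^ j * tan j)) n        ≡⟨ tau-cong (+ 2 * a) (λ j → ℤ.*-identityˡ _) n ⟩
    tau (+ 2 * a) (λ n → a ^ n * tan n) n               ∎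

-- Powers of 2 dividing `q`.

pos-^ : ∀ m n → + (m ℕ.^ n) ≡ (+ m) ^ n
pos-^ m zero    = refl
pos-^ m (suc n) = trans (ℤ.pos-* m (m ℕ.^ n)) (cong (+ m *_) (pos-^ m n))

^-∣ : ∀ d {m n} → m ≤ n → d ^ m ∣ℤ d ^ n
^-∣ d {m} {n} m≤n with k , refl ← ℕ.m≤n⇒∃[o]m+o≡n m≤n =
  divides (d ^ k) (trans (ℤ.^-distribˡ-+-* d m k) (ℤ.*-comm (d ^ m) (d ^ k)))

*-∣ : ∀ {c d x y} → c ∣ℤ x → d ∣ℤ y → c * d ∣ℤ x * y
*-∣ {c} {d} (divides p refl) (divides r refl) = divides (p * r) (lemma p c r d)
  where
  lemma : ∀ p c r d → p * c * (r * d) ≡ p * r * (c * d)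
  lemma = solve-∀

^-∣-* : ∀ d {m n k} x y → k ≤ m ℕ.+ n → d ^ m ∣ℤ x → d ^ n ∣ℤ y → d ^ k ∣ℤ x * y
^-∣-* d {m} {n} x y k≤ ∣x ∣y = ∣-trans (^-∣ d k≤) (subst (_∣ℤ _) (sym (ℤ.^-distribˡ-+-* d m n)) (*-∣ {d ^ m} {d ^ n} {x} {y} ∣x ∣y))

^-mono-∣ : ∀ d x n → d ∣ℤ x → d ^ n ∣ℤ x ^ n
^-mono-∣ d x zero    d∣x = ∣-refl
^-mono-∣ d x (suc n) d∣x = *-∣ {d} {d ^ n} {x} {x ^ n} d∣x (^-mono-∣ d x n d∣x)

⌊suc/2⌋ : ∀ i → ⌊ suc i /2⌋ ≡ ⌊ i /2⌋ ⊎ (⌊ suc i /2⌋ ≡ suc ⌊ i /2⌋ × 2 ∣ suc i)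
⌊suc/2⌋ 0 = inj₁ refl
⌊suc/2⌋ 1 = inj₂ (refl , ℕ.∣-refl)
⌊suc/2⌋ (suc (suc i)) with ⌊suc/2⌋ i
... | inj₁ eq         = inj₁ (cong suc eq)
... | inj₂ (eq , 2∣i) = inj₂ (cong suc eq , ℕ.∣m∣n⇒∣m+n ℕ.∣-refl 2∣i)

-- Raising the index by d + 2 raises its half by at most d + 1, so the factor (2a)ᵈ⁺² leaves one 2
-- to spare.
⌊+2+d/2⌋ : ∀ i d → suc ⌊ i ℕ.+ (2 ℕ.+ d) /2⌋ ≤ 2 ℕ.+ d ℕ.+ ⌊ i /2⌋
⌊+2+d/2⌋ i d rewrite ℕ.+-comm i (2 ℕ.+ d) = s≤s (s≤s (go d))
  where
  go : ∀ d → ⌊ d ℕ.+ i /2⌋ ≤ d ℕ.+ ⌊ i /2⌋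
  go zero          = ℕ.≤-refl
  go (suc zero)    = ℕ.≤-trans (ℕ.⌊n/2⌋-mono (ℕ.n≤1+n (suc i))) ℕ.≤-refl
  go (suc (suc d)) = s≤s (ℕ.m≤n⇒m≤1+n (go d))

2∣2a : ∀ a n → (+ 2) ^ n ∣ℤ (+ 2 * a) ^ n
2∣2a a n = ^-mono-∣ (+ 2) (+ 2 * a) n (divides a (ℤ.*-comm (+ 2) a))

-- Consecutive indices lose no power of 2 because (i + 1) C i = i + 1 is even whenever ⌊(i + 1)/2⌋ > ⌊i/2⌋.
q-term : ∀ a i d → (+ 2) ^ ⌊ i /2⌋ ∣ℤ q a i →
  (+ 2) ^ suc ⌊ i ℕ.+ suc d /2⌋ ∣ℤ + ((i ℕ.+ suc d) C i) * ((+ 2 * a) ^ suc d * q a i)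
q-term a i zero ∣q rewrite ℕ.+-comm i 1 with ⌊suc/2⌋ i
... | inj₁ eq         = ∣n⇒∣m*n (+ (suc i C i))
  (^-∣-* (+ 2) {1} {⌊ i /2⌋} ((+ 2 * a) ^ 1) (q a i) (ℕ.≤-reflexive (cong suc eq)) (2∣2a a 1) ∣q)
... | inj₂ (eq , 2∣i) = ^-∣-* (+ 2) {1} {suc ⌊ i /2⌋} (+ (suc i C i)) ((+ 2 * a) ^ 1 * q a i) (ℕ.≤-reflexive (cong suc eq))
  (subst (λ c → (+ 2) ^ 1 ∣ℤ + c) (sym C≡) (∣ᵤ⇒∣ 2∣i))
  (^-∣-* (+ 2) {1} {⌊ i /2⌋} ((+ 2 * a) ^ 1) (q a i) ℕ.≤-refl (2∣2a a 1) ∣q)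
  where
  C≡ : suc i C i ≡ suc i
  C≡ = trans (nCk≡nC[n∸k] (ℕ.n≤1+n i)) (trans (cong (suc i C_) (ℕ.m+n∸n≡m 1 i)) (nC1≡n (suc i)))
q-term a i (suc d) ∣q = ∣n⇒∣m*n (+ ((i ℕ.+ suc (suc d)) C i))
  (^-∣-* (+ 2) {2 ℕ.+ d} {⌊ i /2⌋} ((+ 2 * a) ^ (2 ℕ.+ d)) (q a i) (⌊+2+d/2⌋ i d) (2∣2a a (2 ℕ.+ d)) ∣q)

-- For n > 0 `q-functional` writes 2 · `q a n` as minus a sum over smaller indices. By `q-term` each
-- summand has one more factor 2 than required, and that factor is cancelled.
2^∣q : ∀ a n → (+ 2) ^ ⌊ n /2⌋ ∣ℤ q a n
2^∣q a = <-rec _ go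
  where
  go : ∀ n → (∀ {i} → i < n → (+ 2) ^ ⌊ i /2⌋ ∣ℤ q a i) → (+ 2) ^ ⌊ n /2⌋ ∣ℤ q a n
  go zero    ih = divides (q a 0) (sym (ℤ.*-identityʳ _))
  go (suc n) ih = *-cancelˡ-∣ (+ 2) (subst (_ ∣ℤ_) solved
      (∣m⇒∣-m (∑<-∣ (suc n) λ i i<n → term i i<n)))
    where
    term : ∀ i → i < suc n → (+ 2) ^ suc ⌊ suc n /2⌋ ∣ℤ + (suc n C i) * ((+ 2 * a) ^ (suc n ∸ i) * q a i)
    term i (s≤s i≤n) with d , refl ← ℕ.m≤n⇒∃[o]m+o≡n i≤n =
      subst₂ (λ x y → (+ 2) ^ suc ⌊ x /2⌋ ∣ℤ + (x C i) * ((+ 2 * a) ^ y * q a i))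
        (ℕ.+-suc i d) (sym (trans (cong (_∸ i) (sym (ℕ.+-suc i d))) (ℕ.m+n∸m≡n i (suc d))))
        (q-term a i d (ih (s≤s i≤n)))
    S : ℤ
    S = ∑< (suc n) (λ i → + (suc n C i) * ((+ 2 * a) ^ (suc n ∸ i) * q a i))
    solved : - S ≡ + 2 * q a (suc n)
    solved = begin
      - S                                      ≡⟨ lemma S (q a (suc n)) ⟩
      + 2 * q a (suc n) - (S + q a (suc n) + q a (suc n))
        ≡⟨ cong (λ z → + 2 * q a (suc n) - (z + q a (suc n))) (sym (tau-last (+ 2 * a) (q a) (suc n))) ⟩
      + 2 * q a (suc n) - (tau (+ 2 * a) (q a) (suc n) + q a (suc n))
        ≡⟨ cong (_-_ (+ 2 * q a (suc n))) (trans (q-functional a (suc n)) (ℤ.*-zeroʳ (+ 2))) ⟩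
      + 2 * q a (suc n) - 0ℤ                   ≡⟨ ℤ.+-identityʳ _ ⟩
      + 2 * q a (suc n) ∎
      where
      lemma : ∀ s x → - s ≡ + 2 * x - (s + x + x)
      lemma = solve-∀

-- Differences of `E` along even arguments.

e : ℤ → ℕ → ℤ
e a n = tau (+ 2) (λ l → q a (n ℕ.+ l)) n

-- Under x ↦ x + 1 the polynomial (x² − 1)ⁿ becomes xⁿ(x + 2)ⁿ.
tau-square : ∀ v n → tau -1ℤ (λ t → tau 1ℤ v (2 ℕ.* t)) n ≡ tau (+ 2) (λ l → v (n ℕ.+ l)) n
tau-square v zero    = refl
tau-square v (suc n) = begin
  tau -1ℤ (mul-x+ -1ℤ (λ t → tau 1ℤ v (2 ℕ.* t))) n
    ≡⟨ tau-cong -1ℤ double n ⟩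
  tau -1ℤ (λ t → tau 1ℤ (mul-x+ (+ 2) (v ∘ suc)) (2 ℕ.* t)) n
    ≡⟨ tau-square (mul-x+ (+ 2) (v ∘ suc)) n ⟩
  tau (+ 2) (λ l → mul-x+ (+ 2) (v ∘ suc) (n ℕ.+ l)) n
    ≡⟨ tau-cong (+ 2) (λ l → cong (λ z → v (suc z) + + 2 * v (suc (n ℕ.+ l))) (sym (ℕ.+-suc n l))) n ⟩
  tau (+ 2) (mul-x+ (+ 2) (λ l → v (suc n ℕ.+ l))) n ∎
  where
  double : ∀ t → mul-x+ -1ℤ (λ t → tau 1ℤ v (2 ℕ.* t)) t ≡ tau 1ℤ (mul-x+ (+ 2) (v ∘ suc)) (2 ℕ.* t)
  double t = begin
    tau 1ℤ v (2 ℕ.* suc t) + -1ℤ * tau 1ℤ v (2 ℕ.* t)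
      ≡⟨ cong (λ z → tau 1ℤ v z + -1ℤ * tau 1ℤ v (2 ℕ.* t)) (ℕ.*-suc 2 t) ⟩
    tau 1ℤ (mul-x+ 1ℤ (mul-x+ 1ℤ v)) (2 ℕ.* t) + -1ℤ * tau 1ℤ v (2 ℕ.* t)
      ≡⟨ sym (tau-linear 1ℤ -1ℤ (mul-x+ 1ℤ (mul-x+ 1ℤ v)) v (2 ℕ.* t)) ⟩
    tau 1ℤ (λ i → mul-x+ 1ℤ (mul-x+ 1ℤ v) i + -1ℤ * v i) (2 ℕ.* t)
      ≡⟨ tau-cong 1ℤ (λ i → lemma (v (suc (suc i))) (v (suc i)) (v i)) (2 ℕ.* t) ⟩
    tau 1ℤ (mul-x+ (+ 2) (v ∘ suc)) (2 ℕ.* t) ∎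
    where
    lemma : ∀ x y z → (x + 1ℤ * y) + 1ℤ * (y + 1ℤ * z) + -1ℤ * z ≡ x + + 2 * y
    lemma = solve-∀

E-q : ∀ a n → E a n ≡ tau 1ℤ (q a) n
E-q a n = sym (trans (tau-∘ 1ℤ -1ℤ (E a) n) (tau-0 (E a) n))

E-even : ∀ a n → tau -1ℤ (λ t → E a (2 ℕ.* t)) n ≡ e a n
E-even a n = trans (tau-cong -1ℤ (λ t → E-q a (2 ℕ.* t)) n) (tau-square (q a) n)

-- Newton's expansion gives t ↦ E(2t) as `tau 1ℤ` of its differences. After (x + 1)^(T + s) is
-- split, `tau -1ℤ` undoes the s factors and the T factors remain.
E-shift : ∀ a T j → tau -1ℤ (λ s → E a (2 ℕ.* (T ℕ.+ s))) j ≡ tau 1ℤ (λ i → e a (j ℕ.+ i)) T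
E-shift a T j = begin
  tau -1ℤ (λ s → E a (2 ℕ.* (T ℕ.+ s))) j
    ≡⟨ tau-cong -1ℤ expand j ⟩
  tau -1ℤ (tau 1ℤ w) j
    ≡⟨ tau-∘ -1ℤ 1ℤ w j ⟩
  tau 0ℤ w j
    ≡⟨ tau-0 w j ⟩
  tau 1ℤ (λ i → e a (j ℕ.+ i)) T ∎
  where
  w : ℕ → ℤ
  w j = tau 1ℤ (λ i → e a (j ℕ.+ i)) T
  expand : ∀ s → E a (2 ℕ.* (T ℕ.+ s)) ≡ tau 1ℤ w s
  expand s = begin
    E a (2 ℕ.* (T ℕ.+ s))
      ≡⟨ sym (trans (tau-∘ 1ℤ -1ℤ (λ t → E a (2 ℕ.* t)) (T ℕ.+ s)) (tau-0 _ (T ℕ.+ s))) ⟩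
    tau 1ℤ (tau -1ℤ (λ t → E a (2 ℕ.* t))) (T ℕ.+ s)
      ≡⟨ tau-cong 1ℤ (E-even a) (T ℕ.+ s) ⟩
    tau 1ℤ (e a) (T ℕ.+ s)
      ≡⟨ tau-+ 1ℤ (e a) T s ⟩
    tau 1ℤ w s ∎

e-sum : ∀ a n → e a n ≡ ∑< (suc n) (λ l → + (n C l) * ((+ 2) ^ (n ∸ l) * q a (n ℕ.+ l)))
e-sum a n = tau-sum (+ 2) (λ l → q a (n ℕ.+ l)) n

-- In the l-th term 2ⁿ⁻ˡ meets `q a (n + l)`, which is divisible by 2ˡ because l ≤ n gives ⌊(n +
-- l)/2⌋ ≥ l.
2^∣e : ∀ a n → (+ 2) ^ n ∣ℤ e a n
2^∣e a n = subst ((+ 2) ^ n ∣ℤ_) (sym (e-sum a n)) (∑<-∣ (suc n) term)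
  where
  term : ∀ l → l < suc n → (+ 2) ^ n ∣ℤ + (n C l) * ((+ 2) ^ (n ∸ l) * q a (n ℕ.+ l))
  term l (s≤s l≤n) with d , refl ← ℕ.m≤n⇒∃[o]m+o≡n l≤n =
    subst (λ y → (+ 2) ^ (l ℕ.+ d) ∣ℤ + ((l ℕ.+ d) C l) * ((+ 2) ^ y * q a (l ℕ.+ d ℕ.+ l))) (sym (ℕ.m+n∸m≡n l d))
      (∣n⇒∣m*n (+ ((l ℕ.+ d) C l)) (^-∣-* (+ 2) {d} {⌊ l ℕ.+ d ℕ.+ l /2⌋} ((+ 2) ^ d) (q a (l ℕ.+ d ℕ.+ l)) bound ∣-refl (2^∣q a (l ℕ.+ d ℕ.+ l))))
    where
    bound : l ℕ.+ d ≤ d ℕ.+ ⌊ l ℕ.+ d ℕ.+ l /2⌋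
    bound = subst (ℕ._≤ d ℕ.+ ⌊ l ℕ.+ d ℕ.+ l /2⌋) (ℕ.+-comm d l) (ℕ.+-monoʳ-≤ d
      (subst (ℕ._≤ ⌊ l ℕ.+ d ℕ.+ l /2⌋) (sym (ℕ.n≡⌊n+n/2⌋ l)) (ℕ.⌊n/2⌋-mono (ℕ.+-monoˡ-≤ l (ℕ.m≤m+n l d)))))

e-tan : ∀ a n → n < 14 → e a n ≡ ∑< (suc n) (λ l → + (n C l) * ((+ 2) ^ (n ∸ l) * (a ^ (n ℕ.+ l) * tan (n ℕ.+ l))))
e-tan a n (s≤s n≤13) = trans (e-sum a n) (∑<-cong (suc n) λ l l<n →
  cong (λ z → + (n C l) * ((+ 2) ^ (n ∸ l) * z)) (q-tan a (n ℕ.+ l) (s≤s (ℕ.+-mono-≤ n≤13 (ℕ.≤-trans (ℕ.≤-pred l<n) n≤13)))))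

-- Deciding divisibility of polynomial expressions by computation.

private variable n : ℕ

data Expr (n : ℕ) : Set where
  con         : ℤ → Expr n
  var         : Fin n → Expr n
  _⊕_ _⊖_ _⊗_ : Expr n → Expr n → Expr n
  _↑_         : Expr n → ℕ → Expr n

infixl 6 _⊕_ _⊖_
infixl 7 _⊗_
infixr 8 _↑_

⟪_⟫ : Expr n → Vec ℤ n → ℤ
⟪ con c ⟫ ρ = c
⟪ var i ⟫ ρ = lookup ρ i
⟪ x ⊕ y ⟫ ρ = ⟪ x ⟫ ρ + ⟪ y ⟫ ρ
⟪ x ⊖ y ⟫ ρ = ⟪ x ⟫ ρ - ⟪ y ⟫ ρ
⟪ x ⊗ y ⟫ ρ = ⟪ x ⟫ ρ * ⟪ y ⟫ ρ
⟪ x ↑ k ⟫ ρ = ⟪ x ⟫ ρ ^ k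

-- Dense nested Horner form: constant term first in the first variable, with coefficients in the
-- remaining variables.
Poly : ℕ → Set
Poly zero    = ℤ
Poly (suc n) = List (Poly n)

⟦_⟧ : Poly n → Vec ℤ n → ℤ
⟦_⟧ {zero}  c        ρ       = c
⟦_⟧ {suc n} []       ρ       = 0ℤ
⟦_⟧ {suc n} (p ∷ ps) (x ∷ ρ) = ⟦ p ⟧ ρ + x * ⟦ ps ⟧ (x ∷ ρ)

conₚ : ∀ n → ℤ → Poly n
conₚ zero    c = c
conₚ (suc n) c = conₚ n c ∷ []

varₚ : Fin n → Poly n
varₚ {suc n} Fin.zero    = conₚ n 0ℤ ∷ conₚ n 1ℤ ∷ []
varₚ {suc n} (Fin.suc i) = varₚ i ∷ []

addₚ : ∀ n → Poly n → Poly n → Poly n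
addₚ zero    c        d        = c + d
addₚ (suc n) []       qs       = qs
addₚ (suc n) (p ∷ ps) []       = p ∷ ps
addₚ (suc n) (p ∷ ps) (q ∷ qs) = addₚ n p q ∷ addₚ (suc n) ps qs

mulₚ : ∀ n → Poly n → Poly n → Poly n
mulₚ zero    c        d  = c * d
mulₚ (suc n) []       qs = []
mulₚ (suc n) (p ∷ ps) qs = addₚ (suc n) (map (mulₚ n p) qs) (conₚ n 0ℤ ∷ mulₚ (suc n) ps qs)

powₚ : ∀ n → Poly n → ℕ → Poly n
powₚ n p zero    = conₚ n 1ℤ
powₚ n p (suc k) = mulₚ n p (powₚ n p k)

norm : Expr n → Poly n
norm (con c)     = conₚ _ c
norm (var i)     = varₚ i
norm (x ⊕ y)     = addₚ _ (norm x) (norm y)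
norm (x ⊖ y)     = addₚ _ (norm x) (mulₚ _ (conₚ _ -1ℤ) (norm y))
norm (x ⊗ y)     = mulₚ _ (norm x) (norm y)
norm (x ↑ k)     = powₚ _ (norm x) k

⟦con⟧ : ∀ n c (ρ : Vec ℤ n) → ⟦ conₚ n c ⟧ ρ ≡ c
⟦con⟧ zero    c ρ       = refl
⟦con⟧ (suc n) c (x ∷ ρ) = trans (cong₂ _+_ (⟦con⟧ n c ρ) (ℤ.*-zeroʳ x)) (ℤ.+-identityʳ c)

⟦var⟧ : ∀ (i : Fin n) ρ → ⟦ varₚ i ⟧ ρ ≡ lookup ρ i
⟦var⟧ {suc n} Fin.zero (x ∷ ρ) = trans (cong₂ (λ y z → y + x * (z + x * 0ℤ)) (⟦con⟧ n 0ℤ ρ) (⟦con⟧ n 1ℤ ρ)) (lemma x)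
  where
  lemma : ∀ x → 0ℤ + x * (1ℤ + x * 0ℤ) ≡ x
  lemma = solve-∀
⟦var⟧ (Fin.suc i) (x ∷ ρ) = trans (cong₂ _+_ (⟦var⟧ i ρ) (ℤ.*-zeroʳ x)) (ℤ.+-identityʳ _)

⟦add⟧ : ∀ n p q (ρ : Vec ℤ n) → ⟦ addₚ n p q ⟧ ρ ≡ ⟦ p ⟧ ρ + ⟦ q ⟧ ρ
⟦add⟧ zero    p        q        ρ       = refl
⟦add⟧ (suc n) []       qs       ρ       = sym (ℤ.+-identityˡ _)
⟦add⟧ (suc n) (p ∷ ps) []       ρ       = sym (ℤ.+-identityʳ _)
⟦add⟧ (suc n) (p ∷ ps) (q ∷ qs) (x ∷ ρ) =
  trans (cong₂ (λ y z → y + x * z) (⟦add⟧ n p q ρ) (⟦add⟧ (suc n) ps qs (x ∷ ρ)))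
    (lemma x (⟦ p ⟧ ρ) (⟦ q ⟧ ρ) (⟦ ps ⟧ (x ∷ ρ)) (⟦ qs ⟧ (x ∷ ρ)))
  where
  lemma : ∀ x p q r s → (p + q) + x * (r + s) ≡ (p + x * r) + (q + x * s)
  lemma = solve-∀

⟦mul⟧ : ∀ n p q (ρ : Vec ℤ n) → ⟦ mulₚ n p q ⟧ ρ ≡ ⟦ p ⟧ ρ * ⟦ q ⟧ ρ
⟦mul⟧ zero    p        q  ρ       = refl
⟦mul⟧ (suc n) []       qs ρ       = sym (ℤ.*-zeroˡ (⟦ qs ⟧ ρ))
⟦mul⟧ (suc n) (p ∷ ps) qs (x ∷ ρ) = begin
  ⟦ addₚ (suc n) (map (mulₚ n p) qs) (conₚ n 0ℤ ∷ mulₚ (suc n) ps qs) ⟧ (x ∷ ρ)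
    ≡⟨ ⟦add⟧ (suc n) (map (mulₚ n p) qs) (conₚ n 0ℤ ∷ mulₚ (suc n) ps qs) (x ∷ ρ) ⟩
  ⟦ map (mulₚ n p) qs ⟧ (x ∷ ρ) + (⟦ conₚ n 0ℤ ⟧ ρ + x * ⟦ mulₚ (suc n) ps qs ⟧ (x ∷ ρ))
    ≡⟨ cong₂ _+_ (scale qs) (cong₂ (λ y z → y + x * z) (⟦con⟧ n 0ℤ ρ) (⟦mul⟧ (suc n) ps qs (x ∷ ρ))) ⟩
  ⟦ p ⟧ ρ * ⟦ qs ⟧ (x ∷ ρ) + (0ℤ + x * (⟦ ps ⟧ (x ∷ ρ) * ⟦ qs ⟧ (x ∷ ρ)))
    ≡⟨ lemma x (⟦ p ⟧ ρ) (⟦ ps ⟧ (x ∷ ρ)) (⟦ qs ⟧ (x ∷ ρ)) ⟩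
  (⟦ p ⟧ ρ + x * ⟦ ps ⟧ (x ∷ ρ)) * ⟦ qs ⟧ (x ∷ ρ) ∎
  where
  lemma : ∀ x p ps qs → p * qs + (0ℤ + x * (ps * qs)) ≡ (p + x * ps) * qs
  lemma = solve-∀
  lemma′ : ∀ x p q qs → p * q + x * (p * qs) ≡ p * (q + x * qs)
  lemma′ = solve-∀
  scale : ∀ qs → ⟦ map (mulₚ n p) qs ⟧ (x ∷ ρ) ≡ ⟦ p ⟧ ρ * ⟦ qs ⟧ (x ∷ ρ)
  scale []       = sym (ℤ.*-zeroʳ (⟦ p ⟧ ρ))
  scale (q ∷ qs) = trans (cong₂ (λ y z → y + x * z) (⟦mul⟧ n p q ρ) (scale qs))
    (lemma′ x (⟦ p ⟧ ρ) (⟦ q ⟧ ρ) (⟦ qs ⟧ (x ∷ ρ)))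

⟦pow⟧ : ∀ n p k (ρ : Vec ℤ n) → ⟦ powₚ n p k ⟧ ρ ≡ ⟦ p ⟧ ρ ^ k
⟦pow⟧ n p zero    ρ = ⟦con⟧ n 1ℤ ρ
⟦pow⟧ n p (suc k) ρ = trans (⟦mul⟧ n p (powₚ n p k) ρ) (cong (⟦ p ⟧ ρ *_) (⟦pow⟧ n p k ρ))

⟦norm⟧ : ∀ (x : Expr n) ρ → ⟦ norm x ⟧ ρ ≡ ⟪ x ⟫ ρ
⟦norm⟧ (con c) ρ = ⟦con⟧ _ c ρ
⟦norm⟧ (var i) ρ = ⟦var⟧ i ρ
⟦norm⟧ (x ⊕ y) ρ = trans (⟦add⟧ _ (norm x) (norm y) ρ) (cong₂ _+_ (⟦norm⟧ x ρ) (⟦norm⟧ y ρ))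
⟦norm⟧ {n} (x ⊖ y) ρ = begin
  ⟦ addₚ n (norm x) (mulₚ n (conₚ n -1ℤ) (norm y)) ⟧ ρ ≡⟨ ⟦add⟧ n (norm x) _ ρ ⟩
  ⟦ norm x ⟧ ρ + ⟦ mulₚ n (conₚ n -1ℤ) (norm y) ⟧ ρ    ≡⟨ cong₂ _+_ (⟦norm⟧ x ρ) (⟦mul⟧ n (conₚ n -1ℤ) (norm y) ρ) ⟩
  ⟪ x ⟫ ρ + ⟦ conₚ n -1ℤ ⟧ ρ * ⟦ norm y ⟧ ρ            ≡⟨ cong₂ (λ c z → ⟪ x ⟫ ρ + c * z) (⟦con⟧ n -1ℤ ρ) (⟦norm⟧ y ρ) ⟩
  ⟪ x ⟫ ρ + -1ℤ * ⟪ y ⟫ ρ                              ≡⟨ cong (_+_ (⟪ x ⟫ ρ)) (ℤ.-1*i≡-i (⟪ y ⟫ ρ)) ⟩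
  ⟪ x ⟫ ρ - ⟪ y ⟫ ρ ∎
⟦norm⟧ (x ⊗ y) ρ = trans (⟦mul⟧ _ (norm x) (norm y) ρ) (cong₂ _*_ (⟦norm⟧ x ρ) (⟦norm⟧ y ρ))
⟦norm⟧ (x ↑ k) ρ = trans (⟦pow⟧ _ (norm x) k ρ) (cong (_^ k) (⟦norm⟧ x ρ))

-- Tests every coefficient, a sufficient condition for all values to be divisible. For d = 0 it
-- tests that the polynomial is zero.
divides? : ℤ → Poly n → Bool
divides? {zero}  d c        = isYes (d ∣? c)
divides? {suc n} d []       = true
divides? {suc n} d (p ∷ ps) = divides? d p ∧ divides? d ps

divides?-sound : ∀ d (p : Poly n) ρ → T (divides? d p) → d ∣ℤ ⟦ p ⟧ ρ
divides?-sound {zero}  d c        ρ       ok = toWitness {a? = d ∣? c} ok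
divides?-sound {suc n} d []       ρ       ok = divides 0ℤ refl
divides?-sound {suc n} d (p ∷ ps) (x ∷ ρ) ok = ∣m∣n⇒∣m+n
  (divides?-sound d p ρ (proj₁ (Equivalence.to T-∧ ok)))
  (∣n⇒∣m*n x (divides?-sound d ps (x ∷ ρ) (proj₂ (Equivalence.to (T-∧ {divides? d p}) ok))))

∣-expr : ∀ d (x : Expr n) → T (divides? d (norm x)) → ∀ ρ → d ∣ℤ ⟪ x ⟫ ρ
∣-expr d x ok ρ = subst (d ∣ℤ_) (⟦norm⟧ x ρ) (divides?-sound d (norm x) ρ ok)

∑ᴱ : ℕ → (ℕ → Expr n) → Expr n
∑ᴱ zero    f = con 0ℤ
∑ᴱ (suc k) f = f 0 ⊕ ∑ᴱ k (f ∘ suc)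

⟪∑⟫ : ∀ k (f : ℕ → Expr n) ρ → ⟪ ∑ᴱ k f ⟫ ρ ≡ ∑< k (λ i → ⟪ f i ⟫ ρ)
⟪∑⟫ zero    f ρ = refl
⟪∑⟫ (suc k) f ρ = cong (_+_ (⟪ f 0 ⟫ ρ)) (⟪∑⟫ k (f ∘ suc) ρ)

tauᴱ : ℤ → (ℕ → Expr n) → ℕ → Expr n
tauᴱ c f k = ∑ᴱ (suc k) (λ i → con (+ (k C i)) ⊗ (con (c ^ (k ∸ i)) ⊗ f i))

⟪tau⟫ : ∀ c (f : ℕ → Expr n) k ρ → ⟪ tauᴱ c f k ⟫ ρ ≡ tau c (λ i → ⟪ f i ⟫ ρ) k
⟪tau⟫ c f k ρ = trans (⟪∑⟫ (suc k) (λ i → con (+ (k C i)) ⊗ (con (c ^ (k ∸ i)) ⊗ f i)) ρ) (sym (tau-sum c (λ i → ⟪ f i ⟫ ρ) k))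

all< : ℕ → (ℕ → Bool) → Bool
all< zero    f = true
all< (suc n) f = f 0 ∧ all< n (f ∘ suc)

all<-sound : ∀ n f → T (all< n f) → ∀ {i} → i < n → T (f i)
all<-sound (suc n) f ok {zero}  _         = proj₁ (Equivalence.to T-∧ ok)
all<-sound (suc n) f ok {suc i} (s≤s i<n) = all<-sound n (f ∘ suc) (proj₂ (Equivalence.to (T-∧ {f 0}) ok)) i<n

-- A record, so that comparing two such types does not run the computation.
record Checked (d : ℤ) (x : ℕ → Expr n) (N : ℕ) : Set where
  constructor checked
  field ok : T (all< N (λ i → divides? d (norm (x i))))

∣-checked : ∀ d (x : ℕ → Expr n) N → Checked d x N → ∀ {i} → i < N → ∀ ρ → d ∣ℤ ⟪ x i ⟫ ρ
∣-checked d x N (checked ok) {i} i<N = ∣-expr d (x i) (all<-sound N (λ i → divides? d (norm (x i))) ok i<N)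

-- The factor 2¹⁴ in late differences.

eᴱ : Expr n → ℕ → Expr n
eᴱ a n = tauᴱ (+ 2) (λ l → a ↑ (n ℕ.+ l) ⊗ con (tan (n ℕ.+ l))) n

⟪e⟫ : ∀ (a : Expr n) k ρ {x} → ⟪ a ⟫ ρ ≡ x → k < 14 → ⟪ eᴱ a k ⟫ ρ ≡ e x k
⟪e⟫ a k ρ refl k<14 = trans
  (⟪∑⟫ (suc k) (λ l → con (+ (k C l)) ⊗ (con ((+ 2) ^ (k ∸ l)) ⊗ (a ↑ (k ℕ.+ l) ⊗ con (tan (k ℕ.+ l))))) ρ)
  (sym (e-tan (⟪ a ⟫ ρ) k k<14))

-- For indices 8 to 13 these are explicit polynomials in a, checked coefficientwise; from 14 on
-- `2^∣e` suffices.
2^14∣e-small : ∀ a i → i < 6 → (+ 2) ^ 14 ∣ℤ e a (8 ℕ.+ i)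
2^14∣e-small a i i<6 = subst ((+ 2) ^ 14 ∣ℤ_) (⟪e⟫ (var (# 0)) (8 ℕ.+ i) (a ∷ []) {a} refl (ℕ.+-monoʳ-< 8 i<6))
  (∣-checked ((+ 2) ^ 14) (λ i → eᴱ (var (# 0)) (8 ℕ.+ i)) 6 (checked _) i<6 (a ∷ []))

2^14∣e : ∀ a n → 8 ≤ n → (+ 2) ^ 14 ∣ℤ e a n
2^14∣e a n 8≤n = [ small , large ]′ (ℕ.<-≤-connex n 14)
  where
  large : 14 ≤ n → (+ 2) ^ 14 ∣ℤ e a n
  large 14≤n = ∣-trans {j = (+ 2) ^ n} (^-∣ (+ 2) {14} {n} 14≤n) (2^∣e a n)
  small : n < 14 → (+ 2) ^ 14 ∣ℤ e a n
  small n<14 = subst (λ k → (+ 2) ^ 14 ∣ℤ e a k) (ℕ.m+[n∸m]≡n 8≤n)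
    (2^14∣e-small a (n ∸ 8) (ℕ.∸-monoˡ-< n<14 8≤n))

-- Powers of 2 in T C i.

-- Induction on M: if c = w · 2ᴹ, the next factor 2 must divide (2h + 1)w = 2z, and then w = 2(z -
-- hw).
odd-cancel : ∀ h c M → (+ 2) ^ M ∣ℤ (+ 2 * h + 1ℤ) * c → (+ 2) ^ M ∣ℤ c
odd-cancel h c zero    _ = divides c (sym (ℤ.*-identityʳ c))
odd-cancel h c (suc M) d∣ with odd-cancel h c M (∣-trans (^-∣ (+ 2) (ℕ.n≤1+n M)) d∣)
... | divides w refl with *-cancelʳ-∣ ((+ 2) ^ M) {+ 2} {(+ 2 * h + 1ℤ) * w} {{subst ℤ.NonZero (pos-^ 2 M) (ℕ.m^n≢0 2 M)}} (subst ((+ 2) ^ suc M ∣ℤ_) (sym (ℤ.*-assoc (+ 2 * h + 1ℤ) w ((+ 2) ^ M))) d∣)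
... | divides z eq = *-∣ {+ 2} {(+ 2) ^ M} (divides (z - h * w) (trans (lemma h w) (trans (cong (_- + 2 * h * w) eq) (lemma′ h w z)))) ∣-refl
  where
  lemma : ∀ h w → w ≡ (+ 2 * h + 1ℤ) * w - + 2 * h * w
  lemma = solve-∀
  lemma′ : ∀ h w z → z * + 2 - + 2 * h * w ≡ (z - h * w) * + 2
  lemma′ = solve-∀

absorption : ∀ n k → suc k ℕ.* (suc n C suc k) ≡ suc n ℕ.* (n C k)
absorption n       zero    = trans (ℕ.+-identityʳ _) (trans (nC1≡n (suc n)) (sym (ℕ.*-identityʳ (suc n))))
absorption zero    (suc k) = ℕ.*-zeroʳ (suc (suc k))
absorption (suc n) (suc k) = begin
  suc (suc k) ℕ.* (suc (suc n) C suc (suc k))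
    ≡⟨ cong (suc (suc k) ℕ.*_) (sym (nCk+nC[k+1]≡[n+1]C[k+1] (suc n) (suc k))) ⟩
  suc (suc k) ℕ.* (X ℕ.+ (suc n C suc (suc k)))
    ≡⟨ ℕ.*-distribˡ-+ (suc (suc k)) X _ ⟩
  (X ℕ.+ suc k ℕ.* X) ℕ.+ suc (suc k) ℕ.* (suc n C suc (suc k))
    ≡⟨ cong₂ (λ y z → (X ℕ.+ y) ℕ.+ z) (absorption n k) (absorption n (suc k)) ⟩
  (X ℕ.+ suc n ℕ.* (n C k)) ℕ.+ suc n ℕ.* (n C suc k)
    ≡⟨ ℕ.+-assoc X _ _ ⟩
  X ℕ.+ (suc n ℕ.* (n C k) ℕ.+ suc n ℕ.* (n C suc k))
    ≡⟨ cong (X ℕ.+_) (sym (ℕ.*-distribˡ-+ (suc n) (n C k) (n C suc k))) ⟩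
  X ℕ.+ suc n ℕ.* ((n C k) ℕ.+ (n C suc k))
    ≡⟨ cong (λ z → X ℕ.+ suc n ℕ.* z) (nCk+nC[k+1]≡[n+1]C[k+1] n k) ⟩
  suc (suc n) ℕ.* X ∎
  where
  X : ℕ
  X = suc n C suc k

-- The falling factorial x(x - 1)⋯(x - i + 1), a polynomial in x that replaces i! times a binomial
-- coefficient.
ff : ℤ → ℕ → ℤ
ff x zero    = 1ℤ
ff x (suc i) = x * ff (x - 1ℤ) i

ff-C : ∀ n i → + (i !) * + (n C i) ≡ ff (+ n) i
ff-C n       zero    = refl
ff-C zero    (suc i) = trans (ℤ.*-zeroʳ (+ (suc i !))) (sym (ℤ.*-zeroˡ (ff (0ℤ - 1ℤ) i)))
ff-C (suc n) (suc i) = begin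
  + (suc i !) * + (suc n C suc i)           ≡⟨ sym (ℤ.pos-* (suc i !) _) ⟩
  + (suc i ℕ.* i ! ℕ.* (suc n C suc i))     ≡⟨ cong +_ (lemma (suc i) (i !) (suc n C suc i)) ⟩
  + (i ! ℕ.* (suc i ℕ.* (suc n C suc i)))   ≡⟨ cong (λ z → + (i ! ℕ.* z)) (absorption n i) ⟩
  + (i ! ℕ.* (suc n ℕ.* (n C i)))           ≡⟨ cong +_ (lemma′ (i !) (suc n) (n C i)) ⟩
  + (suc n ℕ.* (i ! ℕ.* (n C i)))           ≡⟨ ℤ.pos-* (suc n) _ ⟩
  + suc n * + (i ! ℕ.* (n C i))             ≡⟨ cong (+ suc n *_) (trans (ℤ.pos-* (i !) (n C i)) (ff-C n i)) ⟩
  + suc n * ff (+ n) i                      ∎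
  where
  lemma : ∀ x y z → x ℕ.* y ℕ.* z ≡ y ℕ.* (x ℕ.* z)
  lemma x y z = trans (cong (ℕ._* z) (ℕ.*-comm x y)) (ℕ.*-assoc y x z)
  lemma′ : ∀ x y z → x ℕ.* (y ℕ.* z) ≡ y ℕ.* (x ℕ.* z)
  lemma′ x y z = trans (sym (ℕ.*-assoc x y z)) (lemma x y z)

-- By absorption i · (T C i) = T · ((T - 1) C (i - 1)) for i > 0.
∣iC : ∀ {d} T i → d ∣ℤ + T → d ∣ℤ + i * + (T C i)
∣iC T       zero    d∣T = divides 0ℤ refl
∣iC zero    (suc i) d∣T = divides 0ℤ (ℤ.*-zeroʳ (+ suc i))
∣iC (suc T) (suc i) d∣T = subst (_ ∣ℤ_)
  (trans (sym (ℤ.pos-* (suc T) (T C i))) (trans (cong +_ (sym (absorption T i))) (ℤ.pos-* (suc i) (suc T C suc i))))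
  (∣m⇒∣m*n (+ (T C i)) d∣T)

halve : ∀ i → ∃ λ h → i ≡ h ℕ.+ h ⊎ i ≡ suc (h ℕ.+ h)
halve zero    = 0 , inj₁ refl
halve (suc i) with halve i
... | h , inj₁ eq = h , inj₂ (cong suc eq)
... | h , inj₂ eq = suc h , inj₁ (cong suc (trans eq (sym (ℕ.+-suc h h))))

-- Since 0 < i < 2ʳ⁺¹, i is an odd number times at most r factors 2. Halving i uses up r, and the
-- odd part is cancelled at the end.
cancel-index : ∀ M r i c → 0 < i → i < 2 ℕ.^ suc r → (+ 2) ^ M ∣ℤ + i * c → (+ 2) ^ M ∣ℤ (+ 2) ^ r * c
cancel-index M r i c 0<i i< d∣ with halve i
... | h , inj₂ refl = ∣n⇒∣m*n ((+ 2) ^ r) (odd-cancel (+ h) c M (subst (λ z → (+ 2) ^ M ∣ℤ z * c) odd≡ d∣))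
  where
  odd≡ : + suc (h ℕ.+ h) ≡ + 2 * + h + 1ℤ
  odd≡ = trans (cong +_ (trans (ℕ.+-comm 1 (h ℕ.+ h)) (cong (λ z → h ℕ.+ z ℕ.+ 1) (sym (ℕ.+-identityʳ h))))) (cong (_+ 1ℤ) (ℤ.pos-* 2 h))
cancel-index M zero    i c 0<i (s≤s (s≤s i≤)) d∣ | suc h , inj₁ refl with () ← subst (ℕ._≤ 0) (ℕ.+-suc h h) i≤
cancel-index M (suc r) i c 0<i i< d∣ | suc h , inj₁ refl =
  subst ((+ 2) ^ M ∣ℤ_) (lemma ((+ 2) ^ r) c) (cancel-index M r (suc h) (+ 2 * c) (s≤s z≤n)
    (ℕ.*-cancelˡ-< 2 (suc h) (2 ℕ.^ suc r) (subst (ℕ._< 2 ℕ.^ suc (suc r)) (cong (suc h ℕ.+_) (sym (ℕ.+-identityʳ (suc h)))) i<))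
    (subst ((+ 2) ^ M ∣ℤ_) (lemma′ (+ suc h) c) d∣))
  where
  lemma : ∀ p c → p * (+ 2 * c) ≡ + 2 * p * c
  lemma = solve-∀
  lemma′ : ∀ h c → (h + h) * c ≡ h * (+ 2 * c)
  lemma′ = solve-∀
cancel-index M r i c () i< d∣ | zero , inj₁ refl

-- The r factors 2 that c may lack are lent by x. With μ = m - 1 the target exponent μ + 11 is m +
-- 10.
pow-split-∣ : ∀ μ r c x → (+ 2) ^ μ ∣ℤ (+ 2) ^ r * c → (+ 2) ^ (r ℕ.+ 11) ∣ℤ x → (+ 2) ^ (μ ℕ.+ 11) ∣ℤ c * x
pow-split-∣ μ r c x ∣c (divides w eq) = subst₂ _∣ℤ_ (sym (ℤ.^-distribˡ-+-* (+ 2) μ 11)) (begin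
    (+ 2) ^ r * c * (w * (+ 2) ^ 11)   ≡⟨ lemma ((+ 2) ^ r) c w ((+ 2) ^ 11) ⟩
    c * (w * ((+ 2) ^ r * (+ 2) ^ 11)) ≡⟨ cong (λ z → c * (w * z)) (sym (ℤ.^-distribˡ-+-* (+ 2) r 11)) ⟩
    c * (w * (+ 2) ^ (r ℕ.+ 11))       ≡⟨ cong (c *_) (sym eq) ⟩
    c * x                              ∎)
  (*-∣ {(+ 2) ^ μ} {(+ 2) ^ 11} {(+ 2) ^ r * c} {w * (+ 2) ^ 11} ∣c (∣n⇒∣m*n w ∣-refl))
  where
  lemma : ∀ p c w z → p * c * (w * z) ≡ c * (w * (p * z))
  lemma = solve-∀

16+n<2^[6+n] : ∀ n → 16 ℕ.+ n < 2 ℕ.^ (6 ℕ.+ n)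
16+n<2^[6+n] zero    = ℕ.m≤m+n 17 47
16+n<2^[6+n] (suc n) = ℕ.≤-trans (ℕ.≤-reflexive (ℕ.+-comm 1 (16 ℕ.+ suc n))) (ℕ.≤-trans (ℕ.≤-reflexive (cong (ℕ._+ 1) (ℕ.+-suc 16 n)))
  (ℕ.≤-trans (ℕ.+-mono-≤ (16+n<2^[6+n] n) (ℕ.m^n>0 2 (6 ℕ.+ n)))
    (ℕ.≤-reflexive (cong (2 ℕ.^ (6 ℕ.+ n) ℕ.+_) (sym (ℕ.+-identityʳ (2 ℕ.^ (6 ℕ.+ n))))))))

-- A factor i costs T C i at most its own power of 2. For i < 16 this is at most 2³, and 2¹⁴ = 2³⁺¹¹
-- divides `e a n`. For i ≥ 16 take r = i - 11: then i < 2ʳ⁺¹, and 2ⁱ divides `e a n` because i ≤ n.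
term-∣ : ∀ a T μ n i → (+ 2) ^ μ ∣ℤ + T → 8 ≤ n → i ≤ n → 0 < i → (+ 2) ^ (μ ℕ.+ 11) ∣ℤ + (T C i) * e a n
term-∣ a T μ n i 2^∣T 8≤n i≤n 0<i = [ small , large ]′ (ℕ.<-≤-connex i 16)
  where
  combine : ∀ r → i < 2 ℕ.^ suc r → (+ 2) ^ (r ℕ.+ 11) ∣ℤ e a n → (+ 2) ^ (μ ℕ.+ 11) ∣ℤ + (T C i) * e a n
  combine r i< ∣e = pow-split-∣ μ r (+ (T C i)) (e a n) (cancel-index μ r i (+ (T C i)) 0<i i< (∣iC T i 2^∣T)) ∣e
  small : i < 16 → (+ 2) ^ (μ ℕ.+ 11) ∣ℤ + (T C i) * e a n
  small i<16 = combine 3 i<16 (2^14∣e a n 8≤n)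
  large : 16 ≤ i → (+ 2) ^ (μ ℕ.+ 11) ∣ℤ + (T C i) * e a n
  large 16≤i = combine (5 ℕ.+ (i ∸ 16)) (subst (ℕ._< 2 ℕ.^ (6 ℕ.+ (i ∸ 16))) i≡ (16+n<2^[6+n] (i ∸ 16)))
    (∣-trans {j = (+ 2) ^ n} (^-∣ (+ 2) {5 ℕ.+ (i ∸ 16) ℕ.+ 11} {n}
      (ℕ.≤-trans (ℕ.≤-reflexive (trans (ℕ.+-comm (5 ℕ.+ (i ∸ 16)) 11) i≡)) i≤n)) (2^∣e a n))
    where
    i≡ : 16 ℕ.+ (i ∸ 16) ≡ i
    i≡ = ℕ.m+[n∸m]≡n 16≤i

-- Truncating the Newton expansion.

tau-∣ : ∀ {d} c v → (∀ n → d ∣ℤ v n) → ∀ n → d ∣ℤ tau c v n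
tau-∣ c v d∣v zero    = d∣v 0
tau-∣ c v d∣v (suc n) = tau-∣ c (mul-x+ c v) (λ i → ∣m∣n⇒∣m+n (d∣v (suc i)) (∣n⇒∣m*n c (d∣v i))) n

-- Pads the sum with K terms where T C i = 0, so that K terms can be split off even when T is
-- smaller than K.
C-sum : ∀ K T w → tau 1ℤ w T ≡ ∑< (suc (K ℕ.+ T)) (λ i → + (T C i) * w i)
C-sum K T w = begin
  tau 1ℤ w T
    ≡⟨ tau-sum 1ℤ w T ⟩
  ∑< (suc T) (λ i → + (T C i) * (1ℤ ^ (T ∸ i) * w i))
    ≡⟨ ∑<-cong (suc T) (λ i _ → cong (λ z → + (T C i) * z) (trans (cong (_* w i) (ℤ.^-zeroˡ (T ∸ i))) (ℤ.*-identityˡ (w i)))) ⟩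
  ∑< (suc T) f
    ≡⟨ sym (ℤ.+-identityʳ _) ⟩
  ∑< (suc T) f + 0ℤ
    -- Vanishing is phrased as divisibility by 0, so that `∑<-∣` covers it.
    ≡⟨ cong (_+_ (∑< (suc T) f)) (sym (0∣⇒≡0 (∑<-∣ K (λ i _ → vanish i)))) ⟩
  ∑< (suc T) f + ∑< K (λ i → f (suc T ℕ.+ i))
    ≡⟨ sym (∑<-++ (suc T) K f) ⟩
  ∑< (suc T ℕ.+ K) f
    ≡⟨ cong (λ z → ∑< (suc z) f) (ℕ.+-comm T K) ⟩
  ∑< (suc (K ℕ.+ T)) f ∎
  where
  f : ℕ → ℤ
  f i = + (T C i) * w i
  vanish : ∀ i → 0ℤ ∣ℤ f (suc T ℕ.+ i)
  vanish i = subst (λ c → 0ℤ ∣ℤ + c * w (suc T ℕ.+ i)) (sym (k>n⇒nCk≡0 (s≤s (ℕ.m≤m+n T i))))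
    (divides 0ℤ (ℤ.*-zeroˡ (w (suc T ℕ.+ i))))

truncate : ∀ {d} K T w → (∀ i → K ≤ i → d ∣ℤ + (T C suc i) * w (suc i)) →
  d ∣ℤ (tau 1ℤ w T - w 0) - ∑< K (λ i → + (T C suc i) * w (suc i))
truncate {d} K T w tail = subst (d ∣ℤ_) (sym rest) (∑<-∣ T (λ i _ → tail (K ℕ.+ i) (ℕ.m≤m+n K i)))
  where
  f : ℕ → ℤ
  f i = + (T C suc i) * w (suc i)
  rest : (tau 1ℤ w T - w 0) - ∑< K f ≡ ∑< T (λ i → f (K ℕ.+ i))
  rest = trans (cong (λ z → z - w 0 - ∑< K f) (trans (C-sum K T w)
      (cong₂ _+_ (ℤ.*-identityˡ (w 0)) (∑<-++ K T f))))
    (lemma (w 0) (∑< K f) (∑< T (λ i → f (K ℕ.+ i))))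
    where
    lemma : ∀ w s t → w + (s + t) - w - s ≡ t
    lemma = solve-∀

-- The polynomial on the right-hand side.

-- The expression in braces of the theorem, with N for 2ᵐk and x for b.
F : ℤ → ℤ → ℤ → ℤ
F a N x = + 7 * a * x ^ 6 - + 6 * a * x ^ 5
  + (+ 3 * a ^ 3 - + 14 * a) * x ^ 4
  + (+ 4 * a ^ 3 + + 56 * a) * x ^ 3
  - (+ 6 * a ^ 4 + + 35 * a ^ 3 - + 12 * a ^ 2 + + 106 * a - + 122) * x ^ 2
  + (+ 38 * a ^ 3 - + 8 * a - + 256) * x
  + (+ 70 * a ^ 3 + + 64 * a ^ 2 - + 81 * a + + 448)
  + N * (x ^ 4 + + 2 * x ^ 3 + + 2 * a * x ^ 2
         + (a ^ 3 + + 2 * a) * x + + 16 - a ^ 3)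

Fᴱ : Expr n → Expr n → Expr n → Expr n
Fᴱ a N x = con (+ 7) ⊗ a ⊗ x ↑ 6 ⊖ con (+ 6) ⊗ a ⊗ x ↑ 5
  ⊕ (con (+ 3) ⊗ a ↑ 3 ⊖ con (+ 14) ⊗ a) ⊗ x ↑ 4
  ⊕ (con (+ 4) ⊗ a ↑ 3 ⊕ con (+ 56) ⊗ a) ⊗ x ↑ 3
  ⊖ (con (+ 6) ⊗ a ↑ 4 ⊕ con (+ 35) ⊗ a ↑ 3 ⊖ con (+ 12) ⊗ a ↑ 2 ⊕ con (+ 106) ⊗ a ⊖ con (+ 122)) ⊗ x ↑ 2
  ⊕ (con (+ 38) ⊗ a ↑ 3 ⊖ con (+ 8) ⊗ a ⊖ con (+ 256)) ⊗ x
  ⊕ (con (+ 70) ⊗ a ↑ 3 ⊕ con (+ 64) ⊗ a ↑ 2 ⊖ con (+ 81) ⊗ a ⊕ con (+ 448))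
  ⊕ N ⊗ (x ↑ 4 ⊕ con (+ 2) ⊗ x ↑ 3 ⊕ con (+ 2) ⊗ a ⊗ x ↑ 2
         ⊕ (a ↑ 3 ⊕ con (+ 2) ⊗ a) ⊗ x ⊕ con (+ 16) ⊖ a ↑ 3)

⟪F⟫ : ∀ (a N x : Expr n) ρ → ⟪ Fᴱ a N x ⟫ ρ ≡ F (⟪ a ⟫ ρ) (⟪ N ⟫ ρ) (⟪ x ⟫ ρ)
⟪F⟫ a N x ρ = refl

Fᵗ : ℤ → ℤ → ℕ → ℤ
Fᵗ a N s = F a N (+ (2 ℕ.* s))

-- The degree in x is 6, so seventh differences vanish at every starting point s, and later
-- differences are differences of these. The coefficient test with divisor 0 proves the polynomial
-- identity.
F-degree : ∀ a N n → tau -1ℤ (Fᵗ a N) (7 ℕ.+ n) ≡ 0ℤ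
F-degree a N n = trans (tau-+ -1ℤ (Fᵗ a N) 7 n)
  (0∣⇒≡0 (tau-∣ -1ℤ (λ s → tau -1ℤ (λ i → Fᵗ a N (s ℕ.+ i)) 7) seventh n))
  where
  shifted : ℕ → Expr 3
  shifted i = Fᴱ (var (# 0)) (var (# 1)) (con (+ 2) ⊗ (var (# 2) ⊕ con (+ i)))
  expand : ∀ s k → ⟪ tauᴱ -1ℤ shifted k ⟫ (a ∷ N ∷ + s ∷ []) ≡ tau -1ℤ (λ i → Fᵗ a N (s ℕ.+ i)) k
  expand s k = trans (⟪tau⟫ -1ℤ shifted k (a ∷ N ∷ + s ∷ []))
    (tau-cong -1ℤ (λ i → trans
      (⟪F⟫ (var (# 0)) (var (# 1)) (con (+ 2) ⊗ (var (# 2) ⊕ con (+ i))) (a ∷ N ∷ + s ∷ []))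
      (cong (F a N) (sym (ℤ.pos-* 2 (s ℕ.+ i))))) k)
  seventh : ∀ s → 0ℤ ∣ℤ tau -1ℤ (λ i → Fᵗ a N (s ℕ.+ i)) 7
  seventh s = subst (0ℤ ∣ℤ_) (expand s 7) (∣-expr 0ℤ (tauᴱ -1ℤ shifted 7) _ (a ∷ N ∷ + s ∷ []))

-- Comparing the differences of order below 7.

ffᴱ : Expr n → ℕ → Expr n
ffᴱ x zero    = con 1ℤ
ffᴱ x (suc i) = x ⊗ ffᴱ (x ⊖ con 1ℤ) i

⟪ff⟫ : ∀ (x : Expr n) i ρ → ⟪ ffᴱ x i ⟫ ρ ≡ ff (⟪ x ⟫ ρ) i
⟪ff⟫ x zero    ρ = refl
⟪ff⟫ x (suc i) ρ = cong (⟪ x ⟫ ρ *_) (⟪ff⟫ (x ⊖ con 1ℤ) i ρ)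

-- Entry i is 7!/(i + 1)!, since the sums below start at T C 1.
7!/ : ℕ → ℤ
7!/ = entry (+ 5040 ∷ + 2520 ∷ + 840 ∷ + 210 ∷ + 42 ∷ + 7 ∷ + 1 ∷ [])

7!/-! : ∀ {i} → i < 7 → 7!/ i * + (suc i !) ≡ + 5040
7!/-! = toWitness {a? = ℕ.allUpTo? (λ i → 7!/ i * + (suc i !) ℤ.≟ + 5040) 7} _

-- With K = 7!, which clears the denominators of the binomial coefficients, T · Y = 7! · Δ.
Y : ℤ → Expr n → Expr n → ℕ → Expr n
Y K a T j = ∑ᴱ (7 ∸ j) (λ i → con (7!/ i) ⊗ (ffᴱ (T ⊖ con 1ℤ) i ⊗ eᴱ a (j ℕ.+ suc i)))
  ⊖ con K ⊗ (con (+ 2) ⊗ tauᴱ -1ℤ (λ s → Fᴱ a (con (+ 2) ⊗ T) (con (+ (2 ℕ.* s)))) j)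

-- The j-th difference of left minus right side, keeping only the values of `e` at indices up to 7.
Δ : ℕ → ℤ → ℕ → ℤ
Δ T a j = ∑< (7 ∸ j) (λ i → + (T C suc i) * e a (j ℕ.+ suc i)) - + 2 * + T * tau -1ℤ (Fᵗ a (+ 2 * + T)) j

module _ (T : ℕ) (a : ℤ) (aᴱ Tᴱ : Expr n) (ρ : Vec ℤ n) (a≡ : ⟪ aᴱ ⟫ ρ ≡ a) (T≡ : ⟪ Tᴱ ⟫ ρ ≡ + T) where

  -- Each (i + 1)! · (T C (i + 1)) is T times the falling factorial of T - 1 of length i, so T
  -- factors out of the whole difference.
  ⟪Y⟫ : ∀ K → (∀ {i} → i < 7 → 7!/ i * + (suc i !) ≡ K) →
    ∀ j → j < 7 → + T * ⟪ Y K aᴱ Tᴱ j ⟫ ρ ≡ K * Δ T a j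
  ⟪Y⟫ K K≡ j (s≤s j≤6) = begin
    + T * (⟪ ∑ᴱ (7 ∸ j) u ⟫ ρ - K * (+ 2 * ⟪ tauᴱ -1ℤ v j ⟫ ρ))
      ≡⟨ cong₂ (λ y z → + T * (y - K * (+ 2 * z))) (⟪∑⟫ (7 ∸ j) u ρ) (trans (⟪tau⟫ -1ℤ v j ρ) (tau-cong -1ℤ F≡ j)) ⟩
    + T * (∑< (7 ∸ j) (λ i → ⟪ u i ⟫ ρ) - K * (+ 2 * P))
      ≡⟨ lemma₁ K (+ T) (∑< (7 ∸ j) (λ i → ⟪ u i ⟫ ρ)) P ⟩
    + T * ∑< (7 ∸ j) (λ i → ⟪ u i ⟫ ρ) - K * (+ 2 * + T * P)
      ≡⟨ cong (_- K * (+ 2 * + T * P)) (trans (sym (∑<-* (7 ∸ j) (+ T) (λ i → ⟪ u i ⟫ ρ)))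
           (trans (∑<-cong (7 ∸ j) summand) (∑<-* (7 ∸ j) K w))) ⟩
    K * ∑< (7 ∸ j) w - K * (+ 2 * + T * P)
      ≡⟨ lemma₂ K (∑< (7 ∸ j) w) (+ 2 * + T * P) ⟩
    K * (∑< (7 ∸ j) w - + 2 * + T * P) ∎
    where
    u v : ℕ → Expr _
    u i = con (7!/ i) ⊗ (ffᴱ (Tᴱ ⊖ con 1ℤ) i ⊗ eᴱ aᴱ (j ℕ.+ suc i))
    v s = Fᴱ aᴱ (con (+ 2) ⊗ Tᴱ) (con (+ (2 ℕ.* s)))
    w : ℕ → ℤ
    w i = + (T C suc i) * e a (j ℕ.+ suc i)
    P : ℤ
    P = tau -1ℤ (Fᵗ a (+ 2 * + T)) j
    lemma₁ : ∀ k t s p → t * (s - k * (+ 2 * p)) ≡ t * s - k * (+ 2 * t * p)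
    lemma₁ = solve-∀
    lemma₂ : ∀ k s p → k * s - k * p ≡ k * (s - p)
    lemma₂ = solve-∀
    F≡ : ∀ s → ⟪ v s ⟫ ρ ≡ Fᵗ a (+ 2 * + T) s
    F≡ s = trans (⟪F⟫ aᴱ (con (+ 2) ⊗ Tᴱ) (con (+ (2 ℕ.* s))) ρ)
      (cong₂ (λ x y → F x (+ 2 * y) (+ (2 ℕ.* s))) a≡ T≡)
    summand : ∀ i → i < 7 ∸ j → + T * ⟪ u i ⟫ ρ ≡ K * w i
    summand i i< = begin
      + T * (7!/ i * (⟪ ffᴱ (Tᴱ ⊖ con 1ℤ) i ⟫ ρ * ⟪ eᴱ aᴱ (j ℕ.+ suc i) ⟫ ρ))
        ≡⟨ cong₂ (λ y z → + T * (7!/ i * (y * z)))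
             (trans (⟪ff⟫ (Tᴱ ⊖ con 1ℤ) i ρ) (cong (λ z → ff (z - 1ℤ) i) T≡))
             (⟪e⟫ aᴱ (j ℕ.+ suc i) ρ a≡ (ℕ.≤-trans (s≤s j+i<) (ℕ.m≤m+n 8 6))) ⟩
      + T * (7!/ i * (ff (+ T - 1ℤ) i * e a (j ℕ.+ suc i)))
        ≡⟨ lemma₃ (+ T) (7!/ i) (ff (+ T - 1ℤ) i) (e a (j ℕ.+ suc i)) ⟩
      7!/ i * ff (+ T) (suc i) * e a (j ℕ.+ suc i)
        ≡⟨ cong (λ z → 7!/ i * z * e a (j ℕ.+ suc i)) (sym (ff-C T (suc i))) ⟩
      7!/ i * (+ (suc i !) * + (T C suc i)) * e a (j ℕ.+ suc i)
        ≡⟨ lemma₄ (7!/ i) (+ (suc i !)) (+ (T C suc i)) (e a (j ℕ.+ suc i)) ⟩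
      7!/ i * + (suc i !) * w i
        ≡⟨ cong (_* w i) (K≡ (ℕ.<-≤-trans i< (ℕ.m∸n≤m 7 j))) ⟩
      K * w i ∎
      where
      j+i< : j ℕ.+ suc i ≤ 7
      j+i< = subst (j ℕ.+ suc i ≤_) (ℕ.m+[n∸m]≡n (ℕ.m≤n⇒m≤1+n j≤6)) (ℕ.+-monoʳ-≤ j i<)
      lemma₃ : ∀ t c f x → t * (c * (f * x)) ≡ c * (t * f) * x
      lemma₃ = solve-∀
      lemma₄ : ∀ c f b x → c * (f * b) * x ≡ c * f * (b * x)
      lemma₄ = solve-∀

-- Splitting a modulo 4 is needed: in terms of d with a = 2d + 1 the congruences still hold
-- for all values, but not for all coefficients.
aᴱ : ℤ → Expr 2
aᴱ r = con (+ 4) ⊗ var (# 0) ⊕ con r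

-- T = 2ᵐ⁻¹k is a multiple of 16 because m ≥ 5; the second variable is T/16.
Tᴱ : Expr 2
Tᴱ = con (+ 16) ⊗ var (# 1)

-- The exponent is 15 = 11 + 4: the factor T supplies 2 to the power μ, and 4 factors 2 are lost on
-- cancelling 5040 = 16 · 315.
Y-checked : ℤ → Set
Y-checked r = Checked ((+ 2) ^ 15) (Y (+ 5040) (aᴱ r) Tᴱ) 7

Y-check₁ : Y-checked (+ 1)
Y-check₁ = checked _

Y-check₃ : Y-checked (+ 3)
Y-check₃ = checked _

2^∣Y : ∀ r → Y-checked r → ∀ {j} → j < 7 → ∀ ρ → (+ 2) ^ 15 ∣ℤ ⟪ Y (+ 5040) (aᴱ r) Tᴱ j ⟫ ρ
2^∣Y r = ∣-checked ((+ 2) ^ 15) (Y (+ 5040) (aᴱ r) Tᴱ) 7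

5040-cancel : ∀ M x → (+ 2) ^ (4 ℕ.+ M) ∣ℤ + 5040 * x → (+ 2) ^ M ∣ℤ x
5040-cancel M x d∣ = *-cancelˡ-∣ (+ 16) (subst (_∣ℤ + 16 * x) (ℤ.^-distribˡ-+-* (+ 2) 4 M)
  -- 315 = 2 · 157 + 1.
  (odd-cancel (+ 157) (+ 16 * x) (4 ℕ.+ M) (subst ((+ 2) ^ (4 ℕ.+ M) ∣ℤ_) (ℤ.*-assoc (+ 315) (+ 16) x) d∣)))

^-∣-transport : ∀ {m n x y z} → x * y ≡ z → (+ 2) ^ m ∣ℤ x → (+ 2) ^ n ∣ℤ y → (+ 2) ^ (m ℕ.+ n) ∣ℤ z
^-∣-transport {m} {n} {x} {y} refl ∣x ∣y = ^-∣-* (+ 2) {m} {n} {m ℕ.+ n} x y ℕ.≤-refl ∣x ∣y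

2^∣Δ : ∀ μ r d τ a T → Y-checked r → + 4 * d + r ≡ a → + 16 * τ ≡ + T → (+ 2) ^ μ ∣ℤ + T →
  ∀ j → j < 7 → (+ 2) ^ (μ ℕ.+ 11) ∣ℤ Δ T a j
2^∣Δ μ r d τ a T ok a≡ T≡ 2^∣T j j<7 = 5040-cancel (μ ℕ.+ 11) (Δ T a j)
  (subst (λ k → (+ 2) ^ k ∣ℤ + 5040 * Δ T a j) (trans (sym (ℕ.+-assoc μ 11 4)) (ℕ.+-comm (μ ℕ.+ 11) 4))
    (^-∣-transport {μ} {15} {+ T} {⟪ Y (+ 5040) (aᴱ r) Tᴱ j ⟫ (d ∷ τ ∷ [])} {+ 5040 * Δ T a j} (⟪Y⟫ T a (aᴱ r) Tᴱ (d ∷ τ ∷ []) a≡ T≡ (+ 5040) 7!/-! j j<7) 2^∣T (2^∣Y r ok j<7 (d ∷ τ ∷ []))))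

-- From differences to values.

-- `term-∣` removes the terms with index at least 8, and `2^∣Δ` settles the rest when j < 7. For j ≥
-- 7 the remaining sum is empty and `F-degree` removes the other side.
difference-∣ : ∀ μ r d τ a T → Y-checked r → + 4 * d + r ≡ a → + 16 * τ ≡ + T → (+ 2) ^ μ ∣ℤ + T →
  ∀ j → (+ 2) ^ (μ ℕ.+ 11) ∣ℤ
    (tau 1ℤ (λ i → e a (j ℕ.+ i)) T - e a j) - + 2 * + T * tau -1ℤ (Fᵗ a (+ 2 * + T)) j
difference-∣ μ r d τ a T ok a≡ T≡ 2^∣T j = subst ((+ 2) ^ (μ ℕ.+ 11) ∣ℤ_) total
  (∣m∣n⇒∣m+n (truncate (7 ∸ j) T w tail) ([ 2^∣Δ μ r d τ a T ok a≡ T≡ 2^∣T j , high ]′ (ℕ.<-≤-connex j 7)))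
  where
  w : ℕ → ℤ
  w i = e a (j ℕ.+ i)
  P : ℤ
  P = tau -1ℤ (Fᵗ a (+ 2 * + T)) j
  tail : ∀ i → 7 ∸ j ≤ i → (+ 2) ^ (μ ℕ.+ 11) ∣ℤ + (T C suc i) * w (suc i)
  tail i 7∸j≤i = term-∣ a T μ (j ℕ.+ suc i) (suc i) 2^∣T
    (subst (8 ≤_) (sym (ℕ.+-suc j i)) (s≤s (ℕ.≤-trans (ℕ.m≤n+m∸n 7 j) (ℕ.+-monoʳ-≤ j 7∸j≤i))))
    (ℕ.m≤n+m (suc i) j) (s≤s z≤n)
  S : ℤ
  S = ∑< (7 ∸ j) (λ i → + (T C suc i) * w (suc i))
  high : 7 ≤ j → (+ 2) ^ (μ ℕ.+ 11) ∣ℤ Δ T a j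
  high 7≤j = divides 0ℤ (begin
    S - + 2 * + T * P ≡⟨ cong₂ (λ K p → ∑< K (λ i → + (T C suc i) * w (suc i)) - + 2 * + T * p) (ℕ.m≤n⇒m∸n≡0 7≤j)
                           (trans (cong (tau -1ℤ (Fᵗ a (+ 2 * + T))) (sym (ℕ.m+[n∸m]≡n 7≤j))) (F-degree a (+ 2 * + T) (j ∸ 7))) ⟩
    0ℤ - + 2 * + T * 0ℤ ≡⟨ cong (λ z → 0ℤ - z) (ℤ.*-zeroʳ (+ 2 * + T)) ⟩
    0ℤ ∎)
  total : (tau 1ℤ w T - w 0) - S + (S - + 2 * + T * P) ≡ (tau 1ℤ w T - e a j) - + 2 * + T * P
  total = trans (lemma (tau 1ℤ w T) (w 0) S (+ 2 * + T * P))
    (cong (λ z → (tau 1ℤ w T - z) - + 2 * + T * P) (cong (e a) (ℕ.+-identityʳ j)))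
    where
    lemma : ∀ t w s p → (t - w) - s + (s - p) ≡ (t - w) - p
    lemma = solve-∀

-- A sequence in s is an integral combination of its differences at 0, so a common divisor of these
-- divides every value.
E-congruence : ∀ μ r d τ a T → Y-checked r → + 4 * d + r ≡ a → + 16 * τ ≡ + T → (+ 2) ^ μ ∣ℤ + T →
  ∀ s → (+ 2) ^ (μ ℕ.+ 11) ∣ℤ E a (2 ℕ.* (T ℕ.+ s)) - E a (2 ℕ.* s) - + 2 * + T * Fᵗ a (+ 2 * + T) s
E-congruence μ r d τ a T ok a≡ T≡ 2^∣T s = subst ((+ 2) ^ (μ ℕ.+ 11) ∣ℤ_)
  (trans (tau-∘ 1ℤ -1ℤ g s) (trans (tau-0 g s) (signs (u s) (v s) (+ 2 * + T) (Fᵗ a (+ 2 * + T) s))))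
  (tau-∣ 1ℤ (tau -1ℤ g) (λ j → subst ((+ 2) ^ (μ ℕ.+ 11) ∣ℤ_) (sym (differences j)) (difference-∣ μ r d τ a T ok a≡ T≡ 2^∣T j)) s)
  where
  u v g : ℕ → ℤ
  u s = E a (2 ℕ.* (T ℕ.+ s))
  v s = E a (2 ℕ.* s)
  -- Subtractions are written as scalar multiples to fit `tau-linear`.
  g s = (u s + -1ℤ * v s) + - (+ 2 * + T) * Fᵗ a (+ 2 * + T) s
  signs : ∀ u v n f → (u + -1ℤ * v) + - n * f ≡ u - v - n * f
  signs = solve-∀
  differences : ∀ j → tau -1ℤ g j ≡
    (tau 1ℤ (λ i → e a (j ℕ.+ i)) T - e a j) - + 2 * + T * tau -1ℤ (Fᵗ a (+ 2 * + T)) j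
  differences j = begin
    tau -1ℤ g j
      ≡⟨ tau-linear -1ℤ (- (+ 2 * + T)) (λ s → u s + -1ℤ * v s) (Fᵗ a (+ 2 * + T)) j ⟩
    tau -1ℤ (λ s → u s + -1ℤ * v s) j + - (+ 2 * + T) * P
      ≡⟨ cong (_+ - (+ 2 * + T) * P) (trans (tau-linear -1ℤ -1ℤ u v j) (cong₂ (λ y z → y + -1ℤ * z) (E-shift a T j) (E-even a j))) ⟩
    (tau 1ℤ (λ i → e a (j ℕ.+ i)) T + -1ℤ * e a j) + - (+ 2 * + T) * P
      ≡⟨ signs (tau 1ℤ (λ i → e a (j ℕ.+ i)) T) (e a j) (+ 2 * + T) P ⟩
    (tau 1ℤ (λ i → e a (j ℕ.+ i)) T - e a j) - + 2 * + T * P ∎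
    where
    P : ℤ
    P = tau -1ℤ (Fᵗ a (+ 2 * + T)) j

-- Residues modulo 4 and the conclusion.

odd-mod-4 : ∀ a → Odd a → ∃ λ d → + 4 * d + + 1 ≡ a ⊎ + 4 * d + + 3 ≡ a
odd-mod-4 .(+ 2 * + n + 1ℤ) (+ n , refl) with halve n
... | h , inj₁ refl = + h , inj₁ (lemma (+ h))
  where
  lemma : ∀ h → + 4 * h + + 1 ≡ + 2 * (h + h) + 1ℤ
  lemma = solve-∀
... | h , inj₂ refl = + h , inj₂ (lemma (+ h))
  where
  lemma : ∀ h → + 4 * h + + 3 ≡ + 2 * (1ℤ + (h + h)) + 1ℤ
  lemma = solve-∀
odd-mod-4 .(+ 2 * -[1+ n ] + 1ℤ) (-[1+ n ] , refl) with halve n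
... | h , inj₁ refl = -[1+ h ] , inj₂ (lemma (+ h))
  where
  lemma : ∀ h → + 4 * - (1ℤ + h) + + 3 ≡ + 2 * - (1ℤ + (h + h)) + 1ℤ
  lemma = solve-∀
... | h , inj₂ refl = -[1+ h ] , inj₁ (lemma (+ h))
  where
  lemma : ∀ h → + 4 * - (1ℤ + h) + + 1 ≡ + 2 * - (+ 2 + (h + h)) + 1ℤ
  lemma = solve-∀

theorem2p2 : (a : ℤ) (k m b : ℕ) → Odd a → k ≥ 1 → m ≥ 5 → 2 ∣ b →
    let x = + b
        N = + (2 ℕ.^ m ℕ.* k)
    in E a (2 ℕ.^ m ℕ.* k ℕ.+ b) - E a b
       ≡ N * (+ 7 * a * x ^ 6 - + 6 * a * x ^ 5
              + (+ 3 * a ^ 3 - + 14 * a) * x ^ 4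
              + (+ 4 * a ^ 3 + + 56 * a) * x ^ 3
              - (+ 6 * a ^ 4 + + 35 * a ^ 3 - + 12 * a ^ 2 + + 106 * a - + 122) * x ^ 2
              + (+ 38 * a ^ 3 - + 8 * a - + 256) * x
              + (+ 70 * a ^ 3 + + 64 * a ^ 2 - + 81 * a + + 448)
              + N * (x ^ 4 + + 2 * x ^ 3 + + 2 * a * x ^ 2
                     + (a ^ 3 + + 2 * a) * x + + 16 - a ^ 3))
       [mod + (2 ℕ.^ (m ℕ.+ 10)) ]
theorem2p2 a k m b odd k≥1 m≥5 (ℕ.divides s b≡) = subst₂ _∣ℤ_ (sym modulus) statement
  (conclude (odd-mod-4 a odd))
  where
  μ N/2 : ℕ
  -- This is m - 1, written so that the factor 16 of T = N/2 is visible.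
  μ = 4 ℕ.+ (m ∸ 5)
  N/2 = 2 ℕ.^ μ ℕ.* k
  M : ℤ
  M = (+ 2) ^ (μ ℕ.+ 11)
  m≡ : suc μ ≡ m
  m≡ = ℕ.m+[n∸m]≡n m≥5
  modulus : + (2 ℕ.^ (m ℕ.+ 10)) ≡ M
  modulus = trans (pos-^ 2 (m ℕ.+ 10)) (cong ((+ 2) ^_)
    (trans (cong (ℕ._+ 10) (sym m≡)) (sym (ℕ.+-suc μ 10))))
  N≡ : 2 ℕ.* N/2 ≡ 2 ℕ.^ m ℕ.* k
  N≡ = trans (sym (ℕ.*-assoc 2 (2 ℕ.^ μ) k)) (cong (λ m → 2 ℕ.^ m ℕ.* k) m≡)
  2s≡ : 2 ℕ.* s ≡ b
  2s≡ = trans (ℕ.*-comm 2 s) (sym b≡)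
  T≡ : + 16 * + (2 ℕ.^ (m ∸ 5) ℕ.* k) ≡ + N/2
  T≡ = trans (sym (ℤ.pos-* 16 (2 ℕ.^ (m ∸ 5) ℕ.* k))) (cong +_ (trans (sym (ℕ.*-assoc 16 (2 ℕ.^ (m ∸ 5)) k))
    (cong (ℕ._* k) (sym (ℕ.^-distribˡ-+-* 2 4 (m ∸ 5))))))
  2^∣T : (+ 2) ^ μ ∣ℤ + N/2
  2^∣T = divides (+ k) (trans (ℤ.pos-* (2 ℕ.^ μ) k) (trans (cong (_* + k) (pos-^ 2 μ)) (ℤ.*-comm ((+ 2) ^ μ) (+ k))))
  G : ℕ → ℕ → ℕ → ℤ
  G x y N = E a x - E a y - + N * F a (+ N) (+ y)
  conclude : (∃ λ d → + 4 * d + + 1 ≡ a ⊎ + 4 * d + + 3 ≡ a) →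
    M ∣ℤ E a (2 ℕ.* (N/2 ℕ.+ s)) - E a (2 ℕ.* s) - + 2 * + N/2 * Fᵗ a (+ 2 * + N/2) s
  conclude (d , inj₁ a≡) = E-congruence μ (+ 1) d (+ (2 ℕ.^ (m ∸ 5) ℕ.* k)) a N/2 Y-check₁ a≡ T≡ 2^∣T s
  conclude (d , inj₂ a≡) = E-congruence μ (+ 3) d (+ (2 ℕ.^ (m ∸ 5) ℕ.* k)) a N/2 Y-check₃ a≡ T≡ 2^∣T s
  statement : E a (2 ℕ.* (N/2 ℕ.+ s)) - E a (2 ℕ.* s) - + 2 * + N/2 * Fᵗ a (+ 2 * + N/2) s ≡ G (2 ℕ.^ m ℕ.* k ℕ.+ b) b (2 ℕ.^ m ℕ.* k)
  statement = trans
    (cong₂ (λ x N → E a x - E a (2 ℕ.* s) - N * F a N (+ (2 ℕ.* s))) (ℕ.*-distribˡ-+ 2 N/2 s) (sym (ℤ.pos-* 2 N/2)))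
    (cong₂ (λ N y → G (N ℕ.+ y) y N) N≡ 2s≡)
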